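{- For every integer $p\ge 0$, the exponential generating function of the $p$-Bernoulli numbers $B_{n,p}$ is $$\sum_{n=0}^{\infty}B_{n,p}\frac{t^{n}}{n!}=\frac{(p+1)\,(t-H_{p})\,e^{pt}}{(e^{t}-1)^{p+1}}+(p+1)\sum_{k=1}^{p}\binom{p}{k}\frac{H_{k}}{(e^{t}-1)^{k+1}}.$$
   Context: The $p$-Bernoulli numbers $B_{n,p}$ ($n\ge 0$, $p\ge 0$ integers) are the rational numbers determined by $B_{0,p}=1$ for all $p\ge 0$ and the recursion $$B_{n+1,p}=p\,B_{n,p}-\frac{(p+1)^{2}}{p+2}\,B_{n,p+1}.$$ Equivalently, $B_{n,p}=\sum_{k=0}^{n}(-1)^{k}{n\brace k}\binom{k+p+1}{k}^{ -1}k!$, where ${n\brace k}$ is the Stirling number of the second kind. In particular $B_{n,0}=B_n$ is the $n$th Bernoulli number. $H_n=\sum_{j=1}^{n}\frac1j$ is the $n$th harmonic number, with $H_0=0$; empty sums are $0$. The identity is understood as an identity of formal Laurent series in $t$ over $\mathbb{Q}$. -}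

module Defs where

open import Algebra.Bundles.Raw using (RawRing)
import Algebra.Definitions.RawMonoid as RawMonoidDefs
import Algebra.Definitions.RawSemiring as RawSemiringDefs
import Algebra.Properties.Monoid.Sum as MonoidSum
open import Data.Fin.Base using (Fin; zero; suc; toℕ)
open import Data.Integer.Base as ℤ using (ℤ; +_; -[1+_])
import Data.Integer.Properties as ℤ
open import Data.Nat.Base as ℕ using (ℕ; zero; suc; z≤n; s≤s; _!)
import Data.Nat.Properties as ℕ
open import Data.Rational.Base as ℚ using (ℚ; 0ℚ; 1ℚ; _/_; 1/_)
import Data.Rational.Properties as ℚ
open import Data.Vec.Functional using (Vector; _∷_)
open import Level using (0ℓ)
open import Relation.Binary.PropositionalEquality
  using (_≡_; _≗_; refl; sym; trans; cong; cong₂; module ≡-Reasoning)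

open MonoidSum ℚ.+-0-monoid using (sum-cong-≗) renaming (sum to sumℚ)

fromℕ : ℕ → ℚ
fromℕ n = + n / 1

1/_! : ℕ → ℚ
1/ n ! = _/_ (+ 1) (n !) {{n ℕ.!≢0}}

-- B n p is the p-Bernoulli number B_{n,p}.

B : ℕ → ℕ → ℚ
B zero    p = 1ℚ
B (suc n) p =
  fromℕ p ℚ.* B n p ℚ.- (+ (suc p ℕ.^ 2) / suc (suc p)) ℚ.* B n (suc p)

H : ℕ → ℚ
H n = sumℚ {n} λ j → + 1 / suc (toℕ j)

Series : Set
Series = ℕ → ℚ

one : Series
one zero    = 1ℚ
one (suc _) = 0ℚ

-- shift d a is t^d · a.

shift : ℕ → Series → Series
shift zero    a n       = a n
shift (suc d) a zero    = 0ℚ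
shift (suc d) a (suc n) = shift d a n

conv : Series → Series → Series
conv a b n = sumℚ {suc n} λ i → a (toℕ i) ℚ.* b (n ℕ.∸ toℕ i)

-- The reciprocal v of u is computed from v₀ = 1/u₀ and
-- v_{n+1} = -(1/u₀) Σ_{i≤n} u_{i+1} v_{n-i}; recips u n lists v_n , … , v₀.

recips : (u : Series) .{{_ : ℚ.NonZero (u 0)}} → ∀ n → Vector ℚ (suc n)
recips u zero    = λ _ → 1/ u 0
recips u (suc n) =
  ℚ.- (1/ u 0 ℚ.* sumℚ (λ i → u (suc (toℕ i)) ℚ.* recips u n i)) ∷ recips u n

recip : (u : Series) .{{_ : ℚ.NonZero (u 0)}} → Series
recip u n = recips u n zero

-- mkLaurent m a is t^{-m} · Σ_n a_n t^n.  The representation is not unique, so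
-- Laurent series are compared by _≈_ below.

record Laurent : Set where
  constructor mkLaurent
  field
    pole   : ℕ
    series : Series

open Laurent public

at : Series → ℤ → ℚ
at a (+ n)    = a n
at a -[1+ _ ] = 0ℚ

-- coeff f k is the coefficient of t^k in f.

coeff : Laurent → ℤ → ℚ
coeff f k = at (series f) (k ℤ.+ + pole f)

infix  4 _≈_
infixl 6 _+_ _-_
infixl 7 _*_
infix  8 -_
infix  9 _⁻¹

_≈_ : Laurent → Laurent → Set
f ≈ g = ∀ k → coeff f k ≡ coeff g k

_+_ : Laurent → Laurent → Laurent
mkLaurent m a + mkLaurent n b =
  mkLaurent (m ℕ.+ n) λ i → shift n a i ℚ.+ shift m b i

-_ : Laurent → Laurent
- mkLaurent m a = mkLaurent m λ i → ℚ.- a i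

_-_ : Laurent → Laurent → Laurent
f - g = f + (- g)

_*_ : Laurent → Laurent → Laurent
mkLaurent m a * mkLaurent n b = mkLaurent (m ℕ.+ n) (conv a b)

const : ℚ → Laurent
const q = mkLaurent 0 λ i → q ℚ.* one i

t : Laurent
t = mkLaurent 0 (shift 1 one)

rawRing : RawRing 0ℓ 0ℓ
rawRing = record
  { Carrier = Laurent
  ; _≈_     = _≈_
  ; _+_     = _+_
  ; _*_     = _*_
  ; -_      = -_
  ; 0#      = const 0ℚ
  ; 1#      = const 1ℚ
  }

open RawRing rawRing public using (0#; 1#)
open RawSemiringDefs (RawRing.rawSemiring rawRing) public using (_^_)
open RawMonoidDefs (RawRing.+-rawMonoid rawRing) public using (sum)

-- Σ₁ n f is f 1 + … + f n.

Σ₁ : ℕ → (ℕ → Laurent) → Laurent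
Σ₁ n f = sum {n} λ i → f (suc (toℕ i))

egf : (ℕ → ℚ) → Laurent
egf a = mkLaurent 0 λ n → a n ℚ.* 1/ n !

e^[_·t] : ℕ → Laurent
e^[ m ·t] = egf λ n → fromℕ (m ℕ.^ n)

-- Being nonzero is witnessed by the position of the lowest nonzero coefficient,
-- which cannot be computed from the series in general.

record Nonzero (f : Laurent) : Set where
  field
    lowest  : ℕ
    vanish  : ∀ {i} → i ℕ.< lowest → series f i ≡ 0ℚ
    leading : ℚ.NonZero (series f lowest)

  unitPart : Series
  unitPart n = series f (n ℕ.+ lowest)

-- f = t^{lowest - pole} · unitPart.

_⁻¹ : (f : Laurent) {{_ : Nonzero f}} → Laurent
_⁻¹ f {{nz}} = mkLaurent lowest (shift (pole f) (recip unitPart {{leading}}))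
  where open Nonzero nz

e^t-1 : Laurent
e^t-1 = e^[ 1 ·t] - 1#

instance
  e^t-1-nonzero : Nonzero e^t-1
  e^t-1-nonzero = record
    { lowest  = 1
    ; vanish  = λ { (s≤s z≤n) → refl }
    ; leading = _
    }

conv-congˡ : ∀ {a a′} b → a ≗ a′ → conv a b ≗ conv a′ b
conv-congˡ b a≗a′ n = sum-cong-≗ {n = suc n} λ i →
  cong (ℚ._* b (n ℕ.∸ toℕ i)) (a≗a′ (toℕ i))

shift-cong : ∀ d {a a′} → a ≗ a′ → shift d a ≗ shift d a′
shift-cong zero    a≗a′ n       = a≗a′ n
shift-cong (suc d) a≗a′ zero    = refl
shift-cong (suc d) a≗a′ (suc n) = shift-cong d a≗a′ n

conv-shiftˡ : ∀ d a b → conv (shift d a) b ≗ shift d (conv a b)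
conv-shiftˡ zero    a b n       = refl
conv-shiftˡ (suc d) a b zero    = trans (ℚ.+-identityʳ _) (ℚ.*-zeroˡ (b 0))
conv-shiftˡ (suc d) a b (suc n) = begin
  0ℚ ℚ.* b (suc n) ℚ.+ conv (shift d a) b n  ≡⟨ cong (ℚ._+ conv (shift d a) b n) (ℚ.*-zeroˡ (b (suc n))) ⟩
  0ℚ ℚ.+ conv (shift d a) b n                ≡⟨ ℚ.+-identityˡ _ ⟩
  conv (shift d a) b n                       ≡⟨ conv-shiftˡ d a b n ⟩
  shift d (conv a b) n                       ∎
  where open ≡-Reasoning

conv-shiftʳ : ∀ d a b → conv a (shift d b) ≗ shift d (conv a b)
conv-shiftʳ zero    a b n       = refl
conv-shiftʳ (suc d) a b zero    = trans (ℚ.+-identityʳ _) (ℚ.*-zeroʳ (a 0))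
conv-shiftʳ (suc d) a b (suc n) = trans (step a n) (conv-shiftʳ d a b n)
  where
  step : ∀ a n → conv a (shift (suc d) b) (suc n) ≡ conv a (shift d b) n
  step a zero    = cong (a 0 ℚ.* shift d b 0 ℚ.+_)
    (trans (ℚ.+-identityʳ _) (ℚ.*-zeroʳ (a 1)))
  step a (suc n) = cong (a 0 ℚ.* shift d b (suc n) ℚ.+_) (step (λ i → a (suc i)) n)

recips-recip : ∀ u .{{_ : ℚ.NonZero (u 0)}} n (i : Fin (suc n)) →
               recips u n i ≡ recip u (n ℕ.∸ toℕ i)
recips-recip u n       zero    = refl
recips-recip u (suc n) (suc i) = recips-recip u n i

conv-recip : ∀ u .{{_ : ℚ.NonZero (u 0)}} → conv u (recip u) ≗ one
conv-recip u zero    = trans (ℚ.+-identityʳ _) (ℚ.*-inverseʳ (u 0))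
conv-recip u (suc n) = begin
  u 0 ℚ.* ℚ.- (1/ u 0 ℚ.* s) ℚ.+ s′    ≡⟨ cong (ℚ._+ s′) (ℚ.neg-distribʳ-* (u 0) _) ⟨
  ℚ.- (u 0 ℚ.* (1/ u 0 ℚ.* s)) ℚ.+ s′  ≡⟨ cong (λ x → ℚ.- x ℚ.+ s′) (ℚ.*-assoc (u 0) _ s) ⟨
  ℚ.- (u 0 ℚ.* 1/ u 0 ℚ.* s) ℚ.+ s′    ≡⟨ cong (λ x → ℚ.- (x ℚ.* s) ℚ.+ s′) (ℚ.*-inverseʳ (u 0)) ⟩
  ℚ.- (1ℚ ℚ.* s) ℚ.+ s′                ≡⟨ cong (λ x → ℚ.- x ℚ.+ s′) (ℚ.*-identityˡ s) ⟩
  ℚ.- s ℚ.+ s′                         ≡⟨ cong (ℚ.- s ℚ.+_) s≡s′ ⟨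
  ℚ.- s ℚ.+ s                          ≡⟨ ℚ.+-inverseˡ s ⟩
  0ℚ                                   ∎
  where
  open ≡-Reasoning
  s  = sumℚ λ i → u (suc (toℕ i)) ℚ.* recips u n i
  s′ = conv (λ i → u (suc i)) (recip u) n
  s≡s′ : s ≡ s′
  s≡s′ = sum-cong-≗ {n = suc n} λ i → cong (u (suc (toℕ i)) ℚ.*_) (recips-recip u n i)

drop-vanishing : ∀ d a → (∀ {i} → i ℕ.< d → a i ≡ 0ℚ) →
                 a ≗ shift d (λ n → a (n ℕ.+ d))
drop-vanishing zero    a a≡0 n       = cong a (sym (ℕ.+-identityʳ n))
drop-vanishing (suc d) a a≡0 zero    = a≡0 (s≤s z≤n)
drop-vanishing (suc d) a a≡0 (suc n) = trans
  (drop-vanishing d (λ i → a (suc i)) (λ i<d → a≡0 (s≤s i<d)) n)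
  (shift-cong d (λ i → cong a (sym (ℕ.+-suc i d))) n)

at-cong : ∀ {a a′} → a ≗ a′ → at a ≗ at a′
at-cong a≗a′ (+ n)    = a≗a′ n
at-cong a≗a′ -[1+ _ ] = refl

at-shift : ∀ d a z → at (shift d a) (+ d ℤ.+ z) ≡ at a z
at-shift zero    a z = cong (at a) (ℤ.+-identityˡ z)
at-shift (suc d) a z = begin
  at (shift (suc d) a) (+ suc d ℤ.+ z)        ≡⟨ cong (at (shift (suc d) a)) (ℤ.+-assoc (+ 1) (+ d) z) ⟩
  at (shift (suc d) a) (ℤ.suc (+ d ℤ.+ z))    ≡⟨ step (+ d ℤ.+ z) ⟩
  at (shift d a) (+ d ℤ.+ z)                  ≡⟨ at-shift d a z ⟩
  at a z                                      ∎
  where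
  open ≡-Reasoning
  step : ∀ z → at (shift (suc d) a) (ℤ.suc z) ≡ at (shift d a) z
  step (+ n)        = refl
  step -[1+ zero ]  = refl
  step -[1+ suc n ] = refl

coeff-shift : ∀ d m a → mkLaurent (d ℕ.+ m) (shift d a) ≈ mkLaurent m a
coeff-shift d m a k = trans (cong (at (shift d a)) lemma) (at-shift d a (k ℤ.+ + m))
  where
  open ≡-Reasoning
  lemma : k ℤ.+ + (d ℕ.+ m) ≡ + d ℤ.+ (k ℤ.+ + m)
  lemma = begin
    k ℤ.+ (+ d ℤ.+ + m)  ≡⟨ ℤ.+-assoc k (+ d) (+ m) ⟨
    k ℤ.+ + d ℤ.+ + m    ≡⟨ cong (ℤ._+ + m) (ℤ.+-comm k (+ d)) ⟩
    + d ℤ.+ k ℤ.+ + m    ≡⟨ ℤ.+-assoc (+ d) k (+ m) ⟩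
    + d ℤ.+ (k ℤ.+ + m)  ∎

*-inverseʳ : ∀ f {{_ : Nonzero f}} → f * f ⁻¹ ≈ 1#
*-inverseʳ f@(mkLaurent m a) {{nz}} k = begin
  at (conv a (shift m v)) z            ≡⟨ at-cong series-eq z ⟩
  at (shift m (shift l one)) z         ≡⟨ coeff-shift m l (shift l one) k ⟩
  coeff (mkLaurent l (shift l one)) k  ≡⟨ cong (λ x → coeff (mkLaurent x (shift l one)) k) (ℕ.+-identityʳ l) ⟨
  coeff (mkLaurent (l ℕ.+ 0) (shift l one)) k  ≡⟨ coeff-shift l 0 one k ⟩
  coeff (mkLaurent 0 one) k            ≡⟨ at-cong (λ i → ℚ.*-identityˡ (one i)) (k ℤ.+ + 0) ⟨
  coeff 1# k                           ∎
  where
  open ≡-Reasoning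
  open Nonzero nz renaming (lowest to l; unitPart to u)
  instance
    _ : ℚ.NonZero (u 0)
    _ = leading
  v = recip u
  z = k ℤ.+ + (m ℕ.+ l)
  series-eq : conv a (shift m v) ≗ shift m (shift l one)
  series-eq n = begin
    conv a (shift m v) n            ≡⟨ conv-shiftʳ m a v n ⟩
    shift m (conv a v) n            ≡⟨ shift-cong m (conv-congˡ v (drop-vanishing l a vanish)) n ⟩
    shift m (conv (shift l u) v) n  ≡⟨ shift-cong m (conv-shiftˡ l u v) n ⟩
    shift m (shift l (conv u v)) n  ≡⟨ shift-cong m (shift-cong l (conv-recip u)) n ⟩
    shift m (shift l one) n         ∎

{-# OPTIONS --safe #-}

-- Write F_p for the generating function of the B_{n,p}, w = e^t - 1 and
-- c_p = (p+1)²/(p+2).  The recursion says F_p′ = p F_p - c_p F_{p+1}.  The defects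
--   X_p = (p+1)(e^t F_p - 1) - c_p w F_{p+1}
-- satisfy the homogeneous system X_p′ = (p+1) X_p - c_p X_{p+1} with X_p(0) = 0, so
-- they all vanish, coefficient by coefficient; it then follows that w F_0 = t, because
-- (w F_0)′ - 1 = X_0.  Over Laurent series, with u = 1/w, the relation X_p = 0 becomes
--   F_p = (p+1) u Q_p,   Q_0 = t,   Q_{p+1} = (1+u) Q_p - 1/(p+1),
-- and Pascal's rule shows that Q_p = (t - H_p)(1+u)^p + Σ_k C(p,k) H_k u^k satisfies
-- the same recursion; finally (1+u)^p = e^{pt} u^p.
module Submission where

open import Algebra.Bundles using (CommutativeRing; Semiring)
import Algebra.Definitions.RawSemiring as RawSemiringDefs
import Algebra.Properties.Semiring.Sum as SemiringSum
import Algebra.Solver.Ring as RingSolver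
open import Algebra.Solver.Ring.AlmostCommutativeRing
  using (_-Raw-AlmostCommutative⟶_; fromCommutativeRing)
open import Data.Fin.Base as Fin using (Fin; zero; suc; toℕ)
import Data.Fin.Properties as Fin
open import Data.Integer.Base as ℤ using (ℤ; +_; -[1+_])
import Data.Integer.Properties as ℤ
import Data.Maybe.Base as Maybe
open import Data.Nat.Base as ℕ using (ℕ; zero; suc; _!)
open import Data.Nat.Combinatorics
  using (_C_; nC1≡n; nCk+nC[k+1]≡[n+1]C[k+1]; k>n⇒nCk≡0)
import Data.Nat.Properties as ℕ
import Data.Nat.Solver as ℕSolver
open import Data.Product.Base using (_,_)
open import Data.Rational.Base as ℚ using (ℚ; 0ℚ; 1ℚ; _/_; toℚᵘ)
import Data.Rational.Properties as ℚ
import Data.Rational.Solver as ℚSolver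
open import Data.Rational.Unnormalised.Base as ℚᵘ using (mkℚᵘ; *≡*)
import Data.Rational.Unnormalised.Properties as ℚᵘ
open import Data.Unit.Base using (⊤; tt)
open import Function.Base using (_∘_)
open import Level using (0ℓ)
open import Relation.Binary.PropositionalEquality as ≡ using (_≡_; _≗_)
import Relation.Binary.Reasoning.Setoid as SetoidReasoning
open import Relation.Nullary.Decidable using (dec⇒maybe)

open import Defs using (fromℕ; 1/_!; H)

-- The recursion lowers n while raising p, so it does not yield F_0 by itself and an induction on p
-- has no starting point. Hence all X_p are treated together, by induction on the coefficient index,
-- and F_0 = t/w is an outcome instead of an input. The shape of X_p comes from the target: multiply
-- Q_{p+1} = (1+u) Q_p - 1/(p+1) by (p+1)² and substitute Q_p = w F_p/(p+1). The result, c_p w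
-- F_{p+1} = (p+1)(e^t F_p - 1), has no poles, so only power series ever have to be differentiated.
-- In X_p′ the one inhomogeneous term is (p+1)² - c_p (p+2), and the value of c_p makes it vanish.
-- The algebra is done over an arbitrary commutative ring with a homomorphism from ℚ, because it
-- serves twice: for power series, where the system is solved, and for Laurent series, where u
-- exists.

private
  module ℚS = ℚSolver.+-*-Solver
  module ℚSum = SemiringSum (CommutativeRing.semiring ℚ.+-*-commutativeRing)

-- Rational arithmetic, harmonic numbers and the absorption identity.

module ℚArithmetic where

  open ≡ using (refl; sym; trans; cong; cong₂)

  -- `_/_` divides out a gcd and so does not compute on variables. Among unnormalised fractions the
  -- identities below become cross-multiplications of integers.
  toℚᵘ-/ : ∀ i n → toℚᵘ (i / suc n) ℚᵘ.≃ mkℚᵘ i n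
  toℚᵘ-/ i n = ℚ.toℚᵘ-fromℚᵘ (mkℚᵘ i n)

  fromℕ-+ : ∀ m n → fromℕ (m ℕ.+ n) ≡ fromℕ m ℚ.+ fromℕ n
  fromℕ-+ m n = ℚ.toℚᵘ-injective (begin-equality
    toℚᵘ (fromℕ (m ℕ.+ n))                 ≃⟨ toℚᵘ-/ (+ (m ℕ.+ n)) 0 ⟩
    mkℚᵘ (+ (m ℕ.+ n)) 0                   ≃⟨ *≡* (cong (ℤ._* + 1) (sym (cong₂ ℤ._+_ (ℤ.*-identityʳ (+ m)) (ℤ.*-identityʳ (+ n))))) ⟩
    mkℚᵘ (+ m) 0 ℚᵘ.+ mkℚᵘ (+ n) 0         ≃⟨ ℚᵘ.+-cong (toℚᵘ-/ (+ m) 0) (toℚᵘ-/ (+ n) 0) ⟨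
    toℚᵘ (fromℕ m) ℚᵘ.+ toℚᵘ (fromℕ n)     ≃⟨ ℚ.toℚᵘ-homo-+ (fromℕ m) (fromℕ n) ⟨
    toℚᵘ (fromℕ m ℚ.+ fromℕ n)             ∎)
    where open ℚᵘ.≤-Reasoning

  fromℕ-* : ∀ m n → fromℕ (m ℕ.* n) ≡ fromℕ m ℚ.* fromℕ n
  fromℕ-* m n = ℚ.toℚᵘ-injective (begin-equality
    toℚᵘ (fromℕ (m ℕ.* n))                 ≃⟨ toℚᵘ-/ (+ (m ℕ.* n)) 0 ⟩
    mkℚᵘ (+ (m ℕ.* n)) 0                   ≃⟨ *≡* (cong (ℤ._* + 1) (ℤ.pos-* m n)) ⟩
    mkℚᵘ (+ m) 0 ℚᵘ.* mkℚᵘ (+ n) 0         ≃⟨ ℚᵘ.*-cong (toℚᵘ-/ (+ m) 0) (toℚᵘ-/ (+ n) 0) ⟨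
    toℚᵘ (fromℕ m) ℚᵘ.* toℚᵘ (fromℕ n)     ≃⟨ ℚ.toℚᵘ-homo-* (fromℕ m) (fromℕ n) ⟨
    toℚᵘ (fromℕ m ℚ.* fromℕ n)             ∎)
    where open ℚᵘ.≤-Reasoning

  fromℕ-suc : ∀ n → fromℕ (suc n) ≡ 1ℚ ℚ.+ fromℕ n
  fromℕ-suc = fromℕ-+ 1

  fromℕ-*-/ : ∀ m d .{{_ : ℕ.NonZero d}} → fromℕ d ℚ.* (+ m / d) ≡ fromℕ m
  fromℕ-*-/ m (suc d) = ℚ.toℚᵘ-injective (begin-equality
    toℚᵘ (fromℕ (suc d) ℚ.* (+ m / suc d))           ≃⟨ ℚ.toℚᵘ-homo-* (fromℕ (suc d)) (+ m / suc d) ⟩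
    toℚᵘ (fromℕ (suc d)) ℚᵘ.* toℚᵘ (+ m / suc d)     ≃⟨ ℚᵘ.*-cong (toℚᵘ-/ (+ suc d) 0) (toℚᵘ-/ (+ m) d) ⟩
    mkℚᵘ (+ suc d) 0 ℚᵘ.* mkℚᵘ (+ m) d               ≃⟨ *≡* cross ⟩
    mkℚᵘ (+ m) 0                                     ≃⟨ toℚᵘ-/ (+ m) 0 ⟨
    toℚᵘ (fromℕ m)                                   ∎)
    where
    open ℚᵘ.≤-Reasoning
    cross : + suc d ℤ.* + m ℤ.* + 1 ≡ + m ℤ.* + (suc d ℕ.+ 0)
    cross = trans (ℤ.*-identityʳ _) (trans (ℤ.*-comm (+ suc d) (+ m)) (cong (λ x → + m ℤ.* + x) (sym (ℕ.+-identityʳ (suc d)))))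

  open ≡.≡-Reasoning

  1/[1+_] : ℕ → ℚ
  1/[1+ n ] = + 1 / suc n

  suc-*-1/ : ∀ n → fromℕ (suc n) ℚ.* 1/[1+ n ] ≡ 1ℚ
  suc-*-1/ n = fromℕ-*-/ 1 (suc n)

  suc-cancelˡ : ∀ n {x y} → fromℕ (suc n) ℚ.* x ≡ fromℕ (suc n) ℚ.* y → x ≡ y
  suc-cancelˡ n {x} {y} eq = begin
    x                                        ≡⟨ lemma x ⟩
    1/[1+ n ] ℚ.* (fromℕ (suc n) ℚ.* x)      ≡⟨ cong (1/[1+ n ] ℚ.*_) eq ⟩
    1/[1+ n ] ℚ.* (fromℕ (suc n) ℚ.* y)      ≡⟨ lemma y ⟨
    y                                        ∎
    where
    lemma : ∀ z → z ≡ 1/[1+ n ] ℚ.* (fromℕ (suc n) ℚ.* z)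
    lemma z = begin
      z                                      ≡⟨ ℚ.*-identityˡ z ⟨
      1ℚ ℚ.* z                               ≡⟨ cong (ℚ._* z) (suc-*-1/ n) ⟨
      fromℕ (suc n) ℚ.* 1/[1+ n ] ℚ.* z      ≡⟨ ℚS.solve 3 (λ a b c → a ℚS.:* b ℚS.:* c ℚS.:= b ℚS.:* (a ℚS.:* c)) refl (fromℕ (suc n)) 1/[1+ n ] z ⟩
      1/[1+ n ] ℚ.* (fromℕ (suc n) ℚ.* z)    ∎

  suc-*-1/! : ∀ n → fromℕ (suc n) ℚ.* 1/ suc n ! ≡ 1/ n !
  suc-*-1/! n = begin
    a ℚ.* c                              ≡⟨ ℚ.*-identityʳ _ ⟨
    -- The factor 1 is written as n! · 1/n!, so that (n+1) · n! can be collected into (n+1)! and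
    -- cancelled against `c`.
    a ℚ.* c ℚ.* 1ℚ                       ≡⟨ cong (a ℚ.* c ℚ.*_) (fromℕ-*-/ 1 (n !) {{n ℕ.!≢0}}) ⟨
    a ℚ.* c ℚ.* (b ℚ.* 1/ n !)           ≡⟨ ℚS.solve 4 (λ a b c d → a ℚS.:* c ℚS.:* (b ℚS.:* d) ℚS.:= (a ℚS.:* b ℚS.:* c) ℚS.:* d) refl a b c (1/ n !) ⟩
    a ℚ.* b ℚ.* c ℚ.* 1/ n !             ≡⟨ cong (λ x → x ℚ.* c ℚ.* 1/ n !) (fromℕ-* (suc n) (n !)) ⟨
    fromℕ (suc n !) ℚ.* c ℚ.* 1/ n !     ≡⟨ cong (ℚ._* 1/ n !) (fromℕ-*-/ 1 (suc n !) {{suc n ℕ.!≢0}}) ⟩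
    1ℚ ℚ.* 1/ n !                        ≡⟨ ℚ.*-identityˡ _ ⟩
    1/ n !                               ∎
    where
    a = fromℕ (suc n)
    b = fromℕ (n !)
    c = 1/ suc n !

  H-suc : ∀ n → H (suc n) ≡ H n ℚ.+ 1/[1+ n ]
  H-suc n = begin
    H (suc n)                                            ≡⟨ ℚSum.sum-init-last {n} (λ j → 1/[1+ toℕ j ]) ⟩
    ℚSum.sum (λ (j : Fin n) → 1/[1+ toℕ (Fin.inject₁ j) ]) ℚ.+ 1/[1+ toℕ (Fin.fromℕ n) ]
      ≡⟨ cong₂ ℚ._+_ (ℚSum.sum-cong-≗ {n} λ j → cong 1/[1+_] (Fin.toℕ-inject₁ j)) (cong 1/[1+_] (Fin.toℕ-fromℕ n)) ⟩
    H n ℚ.+ 1/[1+ n ]                                    ∎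

  -- The absorption identity, by induction on n from Pascal's rule, without division by factorials.
  -- It is what makes Σ C(p,k) u^k/(k+1) summable.
  [k+1]*[n+1]C[k+1]≡[n+1]*nCk : ∀ n k → suc k ℕ.* (suc n C suc k) ≡ suc n ℕ.* (n C k)
  [k+1]*[n+1]C[k+1]≡[n+1]*nCk n zero = begin
    1 ℕ.* (suc n C 1)  ≡⟨ ℕ.*-identityˡ _ ⟩
    suc n C 1          ≡⟨ nC1≡n (suc n) ⟩
    suc n              ≡⟨ ℕ.*-identityʳ (suc n) ⟨
    suc n ℕ.* 1        ∎
  [k+1]*[n+1]C[k+1]≡[n+1]*nCk zero (suc k) = begin
    suc (suc k) ℕ.* (1 C suc (suc k))  ≡⟨ ℕ.*-zeroʳ (suc (suc k)) ⟩
    0                                  ∎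
  [k+1]*[n+1]C[k+1]≡[n+1]*nCk (suc n) (suc k) = begin
    suc (suc k) ℕ.* (suc (suc n) C suc (suc k))
      ≡⟨ cong (suc (suc k) ℕ.*_) (nCk+nC[k+1]≡[n+1]C[k+1] (suc n) (suc k)) ⟨
    -- One copy of `x` is set aside, so that the induction hypothesis fits both remaining products;
    -- Pascal's rule then reassembles another `x` with factor n+1.
    suc (suc k) ℕ.* (x ℕ.+ y)
      ≡⟨ ℕS.solve 3 (λ k x y → (ℕS.con 1 ℕS.:+ (ℕS.con 1 ℕS.:+ k)) ℕS.:* (x ℕS.:+ y) ℕS.:= x ℕS.:+ (ℕS.con 1 ℕS.:+ k) ℕS.:* x ℕS.:+ (ℕS.con 1 ℕS.:+ (ℕS.con 1 ℕS.:+ k)) ℕS.:* y) refl k x y ⟩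
    x ℕ.+ suc k ℕ.* x ℕ.+ suc (suc k) ℕ.* y
      ≡⟨ cong₂ (λ a b → x ℕ.+ a ℕ.+ b) ([k+1]*[n+1]C[k+1]≡[n+1]*nCk n k) ([k+1]*[n+1]C[k+1]≡[n+1]*nCk n (suc k)) ⟩
    x ℕ.+ suc n ℕ.* (n C k) ℕ.+ suc n ℕ.* (n C suc k)
      ≡⟨ ℕS.solve 4 (λ n x a b → x ℕS.:+ (ℕS.con 1 ℕS.:+ n) ℕS.:* a ℕS.:+ (ℕS.con 1 ℕS.:+ n) ℕS.:* b ℕS.:= x ℕS.:+ (ℕS.con 1 ℕS.:+ n) ℕS.:* (a ℕS.:+ b)) refl n x (n C k) (n C suc k) ⟩
    x ℕ.+ suc n ℕ.* (n C k ℕ.+ n C suc k)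
      ≡⟨ cong (λ a → x ℕ.+ suc n ℕ.* a) (nCk+nC[k+1]≡[n+1]C[k+1] n k) ⟩
    suc (suc n) ℕ.* x  ∎
    where
    module ℕS = ℕSolver.+-*-Solver
    x = suc n C suc k
    y = suc n C suc (suc k)

open ℚArithmetic

-- Identities in a commutative ring over ℚ.

module ℚAlgebra
  (R : CommutativeRing 0ℓ 0ℓ)
  (hom : CommutativeRing.rawRing ℚ.+-*-commutativeRing -Raw-AlmostCommutative⟶ fromCommutativeRing R)
  where

  open CommutativeRing R
  open _-Raw-AlmostCommutative⟶_ hom public renaming (⟦_⟧ to ι)
  open RawSemiringDefs (Semiring.rawSemiring semiring) using (_^_)
  open SemiringSum semiring using (sum; sum-cong-≋; sum-init-last; ∑-distrib-+; *-distribˡ-sum)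
  open SetoidReasoning setoid
  open RingSolver (CommutativeRing.rawRing ℚ.+-*-commutativeRing) (fromCommutativeRing R) hom
    (λ p q → Maybe.map (reflexive ∘ ≡.cong ι) (dec⇒maybe (p ℚ.≟ q)))
    using (Polynomial; con; solve; _:=_; _:+_; _:*_; _:-_)

  private
    :1 : ∀ {n} → Polynomial n
    :1 = con 1ℚ

  ι-cong : ∀ {p q} → p ≡ q → ι p ≈ ι q
  ι-cong = reflexive ∘ ≡.cong ι

  -- f and f′ stand for F_p and F_{p+1}, f″ for F_{p+2}; the left-hand side is
  -- the derivative of (p+1)(e^t F_p - 1) - c_p (e^t - 1) F_{p+1}.
  defect-derivative : ∀ n c c′ e w f f′ f″ → e ≈ w + ι 1ℚ → c * (n + ι 1ℚ) ≈ n * n →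
    n * (e * f + e * ((n - ι 1ℚ) * f - c * f′)) - c * (e * f′ + w * (n * f′ - c′ * f″))
    ≈ n * (n * (e * f - ι 1ℚ) - c * (w * f′)) - c * ((n + ι 1ℚ) * (e * f′ - ι 1ℚ) - c′ * (w * f″))
  defect-derivative n c c′ e w f f′ f″ e≈w+1 c*[n+1]≈n*n = begin
    n * (e * f + e * ((n - ι 1ℚ) * f - c * f′)) - c * (e * f′ + w * (n * f′ - c′ * f″))
      ≈⟨ solve 8 (λ n c c′ e w f f′ f″ →
           n :* (e :* f :+ e :* ((n :- :1) :* f :- c :* f′)) :- c :* (e :* f′ :+ w :* (n :* f′ :- c′ :* f″))
           := n :* (n :* (e :* f :- :1) :- c :* (w :* f′)) :- c :* ((n :+ :1) :* (e :* f′ :- :1) :- c′ :* (w :* f″))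
              :+ (n :* n :- c :* (n :+ :1)))
           refl n c c′ e w f f′ f″ ⟩
    rhs + (n * n - c * (n + ι 1ℚ))
      ≈⟨ +-congˡ (trans (+-congˡ (-‿cong c*[n+1]≈n*n)) (-‿inverseʳ (n * n))) ⟩
    rhs + 0#
      ≈⟨ +-identityʳ rhs ⟩
    rhs ∎
    where
    rhs = n * (n * (e * f - ι 1ℚ) - c * (w * f′)) - c * ((n + ι 1ℚ) * (e * f′ - ι 1ℚ) - c′ * (w * f″))

  -- The left-hand side is (w F_0)′ - 1 after inserting w′ = e^t and F_0′ = 0 · F_0 - c_0 F_1.
  defect-zero : ∀ c e w f f′ →
    e * f + w * (ι 0ℚ * f - c * f′) - ι 1ℚ ≈ ι 1ℚ * (e * f - ι 1ℚ) - c * (w * f′)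
  defect-zero = solve 5 (λ c e w f f′ →
    e :* f :+ w :* (con 0ℚ :* f :- c :* f′) :- :1 := :1 :* (e :* f :- :1) :- c :* (w :* f′)) refl

  -- Binomial sums weighted by 1, 1/(k+1) and H_k.

  module Binomial (u : Carrier) where

    term : ℕ → (ℕ → ℚ) → ℕ → Carrier
    term p g k = ι (fromℕ (p C k)) * ι (g k) * u ^ k

    -- Starting at k = 0 gives Pascal's rule a uniform form and costs nothing for the weight `H`,
    -- since H_0 = 0.
    binomialSum : ℕ → (ℕ → ℚ) → Carrier
    binomialSum p g = sum {suc p} λ k → term p g (toℕ k)

    binomialSum-+ : ∀ p {f} g h → (∀ k → f k ≡ g k ℚ.+ h k) →
                    binomialSum p f ≈ binomialSum p g + binomialSum p h
    binomialSum-+ p {f} g h f≡g+h = begin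
      binomialSum p f
        ≈⟨ sum-cong-≋ {suc p} (λ k → split (toℕ k)) ⟩
      sum {suc p} (λ k → term p g (toℕ k) + term p h (toℕ k))
        ≈⟨ ∑-distrib-+ {suc p} (λ k → term p g (toℕ k)) (λ k → term p h (toℕ k)) ⟩
      binomialSum p g + binomialSum p h  ∎
      where
      split : ∀ k → term p f k ≈ term p g k + term p h k
      split k = begin
        ι (fromℕ (p C k)) * ι (f k) * u ^ k
          ≈⟨ *-congʳ (*-congˡ (trans (ι-cong (f≡g+h k)) (+-homo (g k) (h k)))) ⟩
        ι (fromℕ (p C k)) * (ι (g k) + ι (h k)) * u ^ k
          ≈⟨ solve 4 (λ a b c d → a :* (b :+ c) :* d := a :* b :* d :+ a :* c :* d)
               refl (ι (fromℕ (p C k))) (ι (g k)) (ι (h k)) (u ^ k) ⟩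
        term p g k + term p h k  ∎

    -- Pascal's rule on every term with k > 0: the part with C(p,k) completes the old sum, whose
    -- surplus last term has C(p,p+1) = 0, and the part with C(p,k-1) is the sum with shifted weight
    -- and one extra factor u.
    binomialSum-suc : ∀ p g → binomialSum (suc p) g ≈ binomialSum p g + u * binomialSum p (g ∘ suc)
    binomialSum-suc p g = begin
      -- The term at k = 0 is the same for p and p+1, both binomial coefficients being 1.
      term p g 0 + sum {suc p} (λ k → term (suc p) g (suc (toℕ k)))
        ≈⟨ +-congˡ (sum-cong-≋ {suc p} (λ k → pascal (toℕ k))) ⟩
      term p g 0 + sum {suc p} (λ k → term p g (suc (toℕ k)) + u * term p (g ∘ suc) (toℕ k))
        ≈⟨ +-congˡ (∑-distrib-+ {suc p} (λ k → term p g (suc (toℕ k))) (λ k → u * term p (g ∘ suc) (toℕ k))) ⟩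
      term p g 0 + (sum {suc p} (λ k → term p g (suc (toℕ k))) + sum {suc p} (λ k → u * term p (g ∘ suc) (toℕ k)))
        ≈⟨ +-assoc _ _ _ ⟨
      sum {suc (suc p)} (λ k → term p g (toℕ k)) + sum {suc p} (λ k → u * term p (g ∘ suc) (toℕ k))
        ≈⟨ +-cong drop-last (sym (*-distribˡ-sum {suc p} u (λ k → term p (g ∘ suc) (toℕ k)))) ⟩
      binomialSum p g + u * binomialSum p (g ∘ suc)  ∎
      where
      pascal : ∀ k → term (suc p) g (suc k) ≈ term p g (suc k) + u * term p (g ∘ suc) k
      pascal k = begin
        ι (fromℕ (suc p C suc k)) * ι (g (suc k)) * (u * u ^ k)
          ≈⟨ *-congʳ (*-congʳ (ι-cong (≡.trans (≡.cong fromℕ (≡.sym (nCk+nC[k+1]≡[n+1]C[k+1] p k))) (fromℕ-+ (p C k) (p C suc k))))) ⟩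
        ι (fromℕ (p C k) ℚ.+ fromℕ (p C suc k)) * ι (g (suc k)) * (u * u ^ k)
          ≈⟨ *-congʳ (*-congʳ (+-homo (fromℕ (p C k)) (fromℕ (p C suc k)))) ⟩
        (ι (fromℕ (p C k)) + ι (fromℕ (p C suc k))) * ι (g (suc k)) * (u * u ^ k)
          ≈⟨ solve 5 (λ a b c u v → (a :+ b) :* c :* (u :* v) := b :* c :* (u :* v) :+ u :* (a :* c :* v))
               refl (ι (fromℕ (p C k))) (ι (fromℕ (p C suc k))) (ι (g (suc k))) u (u ^ k) ⟩
        term p g (suc k) + u * term p (g ∘ suc) k  ∎
      last-zero : term p g (toℕ (Fin.fromℕ (suc p))) ≈ 0#
      last-zero = begin
        term p g (toℕ (Fin.fromℕ (suc p)))
          ≈⟨ reflexive (≡.cong (term p g) (Fin.toℕ-fromℕ (suc p))) ⟩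
        ι (fromℕ (p C suc p)) * ι (g (suc p)) * u ^ suc p
          ≈⟨ *-congʳ (*-congʳ (ι-cong (≡.cong fromℕ (k>n⇒nCk≡0 (ℕ.n<1+n p))))) ⟩
        ι 0ℚ * ι (g (suc p)) * u ^ suc p
          ≈⟨ solve 2 (λ a b → con 0ℚ :* a :* b := con 0ℚ) refl (ι (g (suc p))) (u ^ suc p) ⟩
        ι 0ℚ
          ≈⟨ 0-homo ⟩
        0# ∎
      drop-last : sum {suc (suc p)} (λ k → term p g (toℕ k)) ≈ binomialSum p g
      drop-last = begin
        sum {suc (suc p)} (λ k → term p g (toℕ k))
          ≈⟨ sum-init-last {suc p} (λ k → term p g (toℕ k)) ⟩
        sum {suc p} (λ k → term p g (toℕ (Fin.inject₁ k))) + term p g (toℕ (Fin.fromℕ (suc p)))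
          ≈⟨ +-cong (sum-cong-≋ {suc p} (λ k → reflexive (≡.cong (term p g) (Fin.toℕ-inject₁ k)))) last-zero ⟩
        binomialSum p g + 0#
          ≈⟨ +-identityʳ _ ⟩
        binomialSum p g  ∎

    -- A constant weight is unchanged by shifting, so `binomialSum-suc` becomes multiplication by
    -- 1+u.
    binomialTheorem : ∀ p → binomialSum p (λ _ → 1ℚ) ≈ (1# + u) ^ p
    binomialTheorem zero = begin
      ι 1ℚ * ι 1ℚ * 1# + 0#  ≈⟨ +-identityʳ _ ⟩
      ι 1ℚ * ι 1ℚ * 1#       ≈⟨ *-identityʳ _ ⟩
      ι 1ℚ * ι 1ℚ            ≈⟨ *-cong 1-homo 1-homo ⟩
      1# * 1#                ≈⟨ *-identityʳ 1# ⟩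
      1#                     ∎
    binomialTheorem (suc p) = begin
      binomialSum (suc p) (λ _ → 1ℚ)
        ≈⟨ binomialSum-suc p (λ _ → 1ℚ) ⟩
      binomialSum p (λ _ → 1ℚ) + u * binomialSum p (λ _ → 1ℚ)
        ≈⟨ +-cong (binomialTheorem p) (*-congˡ (binomialTheorem p)) ⟩
      (1# + u) ^ p + u * (1# + u) ^ p
        ≈⟨ +-congʳ (*-identityˡ _) ⟨
      1# * (1# + u) ^ p + u * (1# + u) ^ p
        ≈⟨ distribʳ _ 1# u ⟨
      (1# + u) ^ suc p  ∎

    -- The antiderivative of (1+u)^p, obtained term by term: absorption turns (p+1) C(p,k)/(k+1)
    -- into C(p+1,k+1), and the added 1 is the missing term at k = 0.
    binomialSum-1/ : ∀ p → ι (fromℕ (suc p)) * (u * binomialSum p 1/[1+_]) + 1# ≈ (1# + u) ^ suc p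
    binomialSum-1/ p = begin
      ι (fromℕ (suc p)) * (u * binomialSum p 1/[1+_]) + 1#
        ≈⟨ +-congʳ (*-assoc _ _ _) ⟨
      (ι (fromℕ (suc p)) * u) * binomialSum p 1/[1+_] + 1#
        ≈⟨ +-congʳ (*-distribˡ-sum {suc p} _ (λ k → term p 1/[1+_] (toℕ k))) ⟩
      sum {suc p} (λ k → (ι (fromℕ (suc p)) * u) * term p 1/[1+_] (toℕ k)) + 1#
        ≈⟨ +-comm _ 1# ⟩
      1# + sum {suc p} (λ k → (ι (fromℕ (suc p)) * u) * term p 1/[1+_] (toℕ k))
        ≈⟨ +-cong (sym first) (sum-cong-≋ {suc p} (λ k → absorb (toℕ k))) ⟩
      binomialSum (suc p) (λ _ → 1ℚ)
        ≈⟨ binomialTheorem (suc p) ⟩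
      (1# + u) ^ suc p  ∎
      where
      first : ι 1ℚ * ι 1ℚ * 1# ≈ 1#
      first = trans (*-identityʳ _) (trans (*-cong 1-homo 1-homo) (*-identityʳ 1#))
      absorbℚ : ∀ k → fromℕ (suc p) ℚ.* (fromℕ (p C k) ℚ.* 1/[1+ k ]) ≡ fromℕ (suc p C suc k)
      absorbℚ k = ≡.trans (≡.sym (ℚ.*-assoc (fromℕ (suc p)) (fromℕ (p C k)) 1/[1+ k ]))
        (≡.trans (≡.cong (ℚ._* 1/[1+ k ]) eq) (≡.trans
          (ℚS.solve 3 (λ a b c → a ℚS.:* b ℚS.:* c ℚS.:= b ℚS.:* (a ℚS.:* c)) ≡.refl (fromℕ (suc k)) x 1/[1+ k ])
          (≡.trans (≡.cong (x ℚ.*_) (suc-*-1/ k)) (ℚ.*-identityʳ x))))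
        where
        x = fromℕ (suc p C suc k)
        eq : fromℕ (suc p) ℚ.* fromℕ (p C k) ≡ fromℕ (suc k) ℚ.* x
        eq = ≡.trans (≡.sym (fromℕ-* (suc p) (p C k)))
          (≡.trans (≡.cong fromℕ (≡.sym ([k+1]*[n+1]C[k+1]≡[n+1]*nCk p k))) (fromℕ-* (suc k) (suc p C suc k)))
      absorb : ∀ k → (ι (fromℕ (suc p)) * u) * term p 1/[1+_] k ≈ term (suc p) (λ _ → 1ℚ) (suc k)
      absorb k = begin
        (ι (fromℕ (suc p)) * u) * (ι (fromℕ (p C k)) * ι 1/[1+ k ] * u ^ k)
          ≈⟨ solve 5 (λ a b c u v → (a :* u) :* (b :* c :* v) := (a :* (b :* c)) :* :1 :* (u :* v))
               refl (ι (fromℕ (suc p))) (ι (fromℕ (p C k))) (ι 1/[1+ k ]) u (u ^ k) ⟩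
        (ι (fromℕ (suc p)) * (ι (fromℕ (p C k)) * ι 1/[1+ k ])) * ι 1ℚ * (u * u ^ k)
          ≈⟨ *-congʳ (*-congʳ (trans (*-homo _ _) (*-congˡ (*-homo _ _)))) ⟨
        ι (fromℕ (suc p) ℚ.* (fromℕ (p C k) ℚ.* 1/[1+ k ])) * ι 1ℚ * (u * u ^ k)
          ≈⟨ *-congʳ (*-congʳ (ι-cong (absorbℚ k))) ⟩
        term (suc p) (λ _ → 1ℚ) (suc k)  ∎

    suc-*-1/-ι : ∀ p → ι (fromℕ (suc p)) * ι 1/[1+ p ] ≈ 1#
    suc-*-1/-ι p = trans (sym (*-homo _ _)) (trans (ι-cong (suc-*-1/ p)) 1-homo)

    -- Shifting the weight H_k produces H_k + 1/(k+1), and `binomialSum-1/` evaluates the sum of the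
    -- second part.
    binomialSum-H-suc : ∀ p → binomialSum (suc p) H ≈
      (1# + u) * binomialSum p H + ι 1/[1+ p ] * ((1# + u) ^ suc p - 1#)
    binomialSum-H-suc p = begin
      binomialSum (suc p) H
        ≈⟨ binomialSum-suc p H ⟩
      s + u * binomialSum p (H ∘ suc)
        ≈⟨ +-congˡ (*-congˡ (binomialSum-+ p H 1/[1+_] H-suc)) ⟩
      s + u * (s + b)
        ≈⟨ solve 3 (λ s u b → s :+ u :* (s :+ b) := (s :+ u :* s) :+ u :* b) refl s u b ⟩
      (s + u * s) + u * b
        ≈⟨ +-cong (trans (+-congʳ (sym (*-identityˡ s))) (sym (distribʳ s 1# u))) (sym (*-identityˡ _)) ⟩
      (1# + u) * s + 1# * (u * b)
        ≈⟨ +-congˡ (*-congʳ (trans (sym (suc-*-1/-ι p)) (*-comm _ _))) ⟩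
      (1# + u) * s + (r * n) * (u * b)
        -- Adding and subtracting 1 prepares for `binomialSum-1/`. Here `1#` is a solver variable,
        -- since solver constants denote images under `ι`.
        ≈⟨ +-congˡ (solve 4 (λ r n x i → (r :* n) :* x := r :* (n :* x :+ i :- i)) refl r n (u * b) 1#) ⟩
      (1# + u) * s + r * (n * (u * b) + 1# - 1#)
        ≈⟨ +-congˡ (*-congˡ (+-congʳ (binomialSum-1/ p))) ⟩
      (1# + u) * s + r * ((1# + u) ^ suc p - 1#)  ∎
      where
      s = binomialSum p H
      b = binomialSum p 1/[1+_]
      n = ι (fromℕ (suc p))
      r = ι 1/[1+ p ]

    module _ (t : Carrier) where

      Q : ℕ → Carrier
      Q p = (t - ι (H p)) * (1# + u) ^ p + binomialSum p H

      Q-zero : Q 0 ≈ t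
      Q-zero = begin
        (t - ι 0ℚ) * 1# + (ι 1ℚ * ι 0ℚ * 1# + 0#)
          ≈⟨ +-cong (*-identityʳ _) (trans (+-identityʳ _) (*-identityʳ _)) ⟩
        (t - ι 0ℚ) + ι 1ℚ * ι 0ℚ
          ≈⟨ solve 1 (λ t → (t :- con 0ℚ) :+ con 1ℚ :* con 0ℚ := t) refl t ⟩
        t  ∎

      -- Passing from H_p to H_{p+1} costs (1+u)^{p+1}/(p+1) in the first summand; the binomial sum
      -- gains the same amount less 1/(p+1), which alone survives.
      Q-suc : ∀ p → Q (suc p) ≈ (1# + u) * Q p - ι 1/[1+ p ]
      Q-suc p = begin
        (t - ι (H (suc p))) * (v * v ^ p) + binomialSum (suc p) H
          ≈⟨ +-cong (*-congʳ (+-congˡ (-‿cong (trans (ι-cong (H-suc p)) (+-homo _ _))))) (binomialSum-H-suc p) ⟩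
        (t - (h + r)) * (v * v ^ p) + (v * s + r * (v * v ^ p - 1#))
          ≈⟨ solve 7 (λ t h r v x s i → (t :- (h :+ r)) :* (v :* x) :+ (v :* s :+ r :* (v :* x :- i)) := v :* ((t :- h) :* x :+ s) :- r :* i)
               refl t h r v (v ^ p) s 1# ⟩
        v * Q p - r * 1#
          ≈⟨ +-congˡ (-‿cong (*-identityʳ r)) ⟩
        v * Q p - r  ∎
        where
        v = 1# + u
        h = ι (H p)
        r = ι 1/[1+ p ]
        s = binomialSum p H

  -- From the relations between consecutive F_p to the explicit formula.

  module _
    (w u t : Carrier) (c : ℕ → ℚ) (F e : ℕ → Carrier)
    (w*u≈1 : w * u ≈ 1#)
    (w*F-zero : w * F 0 ≈ t)
    (w*F-suc : ∀ p → ι (c p) * (w * F (suc p)) ≈ ι (fromℕ (suc p)) * ((w + ι 1ℚ) * F p - ι 1ℚ))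
    (c-eq : ∀ p → c p ℚ.* fromℕ (suc (suc p)) ≡ fromℕ (suc p) ℚ.* fromℕ (suc p))
    (e-zero : e 0 ≈ 1#)
    (e-suc : ∀ p → e (suc p) ≈ (w + ι 1ℚ) * e p)
    where

    open Binomial u

    F-closed : ∀ p → F p ≈ ι (fromℕ (suc p)) * (u * Q t p)
    F-closed zero = begin
      F 0                      ≈⟨ *-identityˡ _ ⟨
      1# * F 0                 ≈⟨ *-congʳ w*u≈1 ⟨
      w * u * F 0              ≈⟨ solve 3 (λ w u f → w :* u :* f := :1 :* (u :* (w :* f))) refl w u (F 0) ⟩
      ι 1ℚ * (u * (w * F 0))   ≈⟨ *-congˡ (*-congˡ (trans w*F-zero (sym (Q-zero t)))) ⟩
      ι 1ℚ * (u * Q t 0)       ∎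
    F-closed (suc p) = begin
      f′
        ≈⟨ trans (*-congʳ (*-identityʳ 1#)) (*-identityˡ f′) ⟨
      1# * 1# * f′
        -- Instead of dividing by c_p, a factor 1 is inserted: c_p (p+2) = (p+1)² makes
        -- `(k * m) * (r * r)` a unit product, and it supplies the `k` that `w*F-suc` asks for.
        ≈⟨ *-congʳ (*-cong unit w*u≈1) ⟨
      ((k * m) * (r * r)) * (w * u) * f′
        ≈⟨ solve 6 (λ k m r w u f → ((k :* m) :* (r :* r)) :* (w :* u) :* f := (m :* (r :* r) :* u) :* (k :* (w :* f))) refl k m r w u f′ ⟩
      (m * (r * r) * u) * (k * (w * f′))
        ≈⟨ *-congˡ (trans (w*F-suc p) (*-congˡ (+-congʳ (*-congˡ (F-closed p))))) ⟩
      (m * (r * r) * u) * (n * ((w + ι 1ℚ) * (n * (u * q)) - ι 1ℚ))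
        -- Each `n` is paired with an `r`, and (w+1)u becomes 1+u by w u = 1. The `r` left over is
        -- the 1/(p+1) in `Q-suc`.
        ≈⟨ solve 6 (λ m r u n w q → (m :* (r :* r) :* u) :* (n :* ((w :+ :1) :* (n :* (u :* q)) :- :1))
             := m :* (u :* ((n :* r) :* (n :* r) :* ((w :* u :+ u) :* q) :- (n :* r) :* r)))
             refl m r u n w q ⟩
      m * (u * ((n * r) * (n * r) * ((w * u + u) * q) - (n * r) * r))
        ≈⟨ *-congˡ (*-congˡ (+-cong
             (trans (*-cong (trans (*-cong nr nr) (*-identityʳ 1#)) (*-congʳ (+-congʳ w*u≈1))) (*-identityˡ _))
             (-‿cong (trans (*-congʳ nr) (*-identityˡ r))))) ⟩
      m * (u * ((1# + u) * q - r))
        ≈⟨ *-congˡ (*-congˡ (Q-suc t p)) ⟨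
      m * (u * Q t (suc p))  ∎
      where
      f′ = F (suc p)
      q = Q t p
      k = ι (c p)
      n = ι (fromℕ (suc p))
      m = ι (fromℕ (suc (suc p)))
      r = ι 1/[1+ p ]
      nr : n * r ≈ 1#
      nr = suc-*-1/-ι p
      unit : (k * m) * (r * r) ≈ 1#
      unit = begin
        (k * m) * (r * r)      ≈⟨ *-congʳ (trans (sym (*-homo _ _)) (trans (ι-cong (c-eq p)) (*-homo _ _))) ⟩
        (n * n) * (r * r)      ≈⟨ solve 2 (λ n r → (n :* n) :* (r :* r) := (n :* r) :* (n :* r)) refl n r ⟩
        (n * r) * (n * r)      ≈⟨ *-cong nr nr ⟩
        1# * 1#                ≈⟨ *-identityʳ 1# ⟩
        1#                     ∎

    -- Each step multiplies both sides by e^t u = (w+1)u = 1+u.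
    e*u^ : ∀ p → e p * u ^ p ≈ (1# + u) ^ p
    e*u^ zero    = trans (*-identityʳ _) e-zero
    e*u^ (suc p) = begin
      e (suc p) * (u * u ^ p)
        ≈⟨ *-congʳ (e-suc p) ⟩
      (w + ι 1ℚ) * e p * (u * u ^ p)
        ≈⟨ solve 4 (λ w e u x → (w :+ :1) :* e :* (u :* x) := (w :* u :+ u) :* (e :* x)) refl w (e p) u (u ^ p) ⟩
      (w * u + u) * (e p * u ^ p)
        ≈⟨ *-cong (+-congʳ w*u≈1) (e*u^ p) ⟩
      (1# + u) * (1# + u) ^ p  ∎

    -- H_0 = 0 removes the term at k = 0, and the outer u raises the exponent from k to k+1.
    u*binomialSum-H : ∀ p → u * binomialSum p H ≈
      sum {p} (λ i → ι (fromℕ (p C suc (toℕ i))) * ι (H (suc (toℕ i))) * u ^ suc (suc (toℕ i)))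
    u*binomialSum-H p = begin
      u * (ι 1ℚ * ι 0ℚ * 1# + s)
        ≈⟨ solve 3 (λ u i s → u :* (:1 :* con 0ℚ :* i :+ s) := u :* s) refl u 1# s ⟩
      u * s
        ≈⟨ *-distribˡ-sum {p} u (λ i → term p H (suc (toℕ i))) ⟩
      sum {p} (λ i → u * term p H (suc (toℕ i)))
        ≈⟨ sum-cong-≋ {p} (λ i → solve 4 (λ u a b x → u :* (a :* b :* x) := a :* b :* (u :* x)) refl
             u (ι (fromℕ (p C suc (toℕ i)))) (ι (H (suc (toℕ i)))) (u ^ suc (toℕ i))) ⟩
      sum {p} (λ i → ι (fromℕ (p C suc (toℕ i))) * ι (H (suc (toℕ i))) * u ^ suc (suc (toℕ i)))  ∎
      where
      s = sum {p} λ i → term p H (suc (toℕ i))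

    F-explicit : ∀ p → F p ≈
      ι (fromℕ (suc p)) * (t - ι (H p)) * e p * u ^ suc p
      + ι (fromℕ (suc p)) *
        sum {p} (λ i → ι (fromℕ (p C suc (toℕ i))) * ι (H (suc (toℕ i))) * u ^ suc (suc (toℕ i)))
    F-explicit p = begin
      F p
        ≈⟨ F-closed p ⟩
      n * (u * (d * (1# + u) ^ p + binomialSum p H))
        ≈⟨ solve 5 (λ n u d x s → n :* (u :* (d :* x :+ s)) := n :* d :* u :* x :+ n :* (u :* s)) refl n u d ((1# + u) ^ p) (binomialSum p H) ⟩
      n * d * u * (1# + u) ^ p + n * (u * binomialSum p H)
        ≈⟨ +-cong (*-congˡ (sym (e*u^ p))) (*-congˡ (u*binomialSum-H p)) ⟩
      n * d * u * (e p * u ^ p) + n * Σ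
        ≈⟨ +-congʳ (solve 5 (λ n d u e x → n :* d :* u :* (e :* x) := n :* d :* e :* (u :* x)) refl n d u (e p) (u ^ p)) ⟩
      n * d * e p * u ^ suc p + n * Σ  ∎
      where
      n = ι (fromℕ (suc p))
      d = t - ι (H p)
      Σ = sum {p} λ i → ι (fromℕ (p C suc (toℕ i))) * ι (H (suc (toℕ i))) * u ^ suc (suc (toℕ i))

-- Formal power series

open import Defs
open ≡ using (refl; sym; trans; cong; cong₂; module ≡-Reasoning)
open ≡-Reasoning
open ℚSum using (sum-cong-≗; ∑-distrib-+; *-distribˡ-sum) renaming (sum to sumℚ)

infixl 6 _⊕_
infix  8 ⊖_

_⊕_ : Series → Series → Series
(a ⊕ b) n = a n ℚ.+ b n

⊖_ : Series → Series
(⊖ a) n = ℚ.- a n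

constant : ℚ → Series
constant q n = q ℚ.* one n

conv-cong : ∀ {a a′ b b′} → a ≗ a′ → b ≗ b′ → conv a b ≗ conv a′ b′
conv-cong a≗a′ b≗b′ n = sum-cong-≗ {suc n} λ i → cong₂ ℚ._*_ (a≗a′ (toℕ i)) (b≗b′ (n ℕ.∸ toℕ i))

-- `conv` unfolds at the end containing `a 0`; commutativity also needs the other end.
conv-suc : ∀ a b n → conv a b (suc n) ≡ conv a (b ∘ suc) n ℚ.+ a (suc n) ℚ.* b 0
conv-suc a b zero = ℚS.solve 2 (λ x y → x ℚS.:+ (y ℚS.:+ ℚS.con 0ℚ) ℚS.:= x ℚS.:+ ℚS.con 0ℚ ℚS.:+ y) refl (a 0 ℚ.* b 1) (a 1 ℚ.* b 0)
conv-suc a b (suc n) = begin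
  x ℚ.+ conv (a ∘ suc) b (suc n)                                 ≡⟨ cong (x ℚ.+_) (conv-suc (a ∘ suc) b n) ⟩
  x ℚ.+ (conv (a ∘ suc) (b ∘ suc) n ℚ.+ a (2 ℕ.+ n) ℚ.* b 0)     ≡⟨ ℚ.+-assoc x _ _ ⟨
  conv a (b ∘ suc) (suc n) ℚ.+ a (2 ℕ.+ n) ℚ.* b 0               ∎
  where x = a 0 ℚ.* b (2 ℕ.+ n)

conv-comm : ∀ a b → conv a b ≗ conv b a
conv-comm a b zero    = cong (ℚ._+ 0ℚ) (ℚ.*-comm (a 0) (b 0))
conv-comm a b (suc n) = begin
  conv a b (suc n)                                   ≡⟨ conv-suc a b n ⟩
  conv a (b ∘ suc) n ℚ.+ a (suc n) ℚ.* b 0           ≡⟨ cong₂ ℚ._+_ (conv-comm a (b ∘ suc) n) (ℚ.*-comm (a (suc n)) (b 0)) ⟩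
  conv (b ∘ suc) a n ℚ.+ b 0 ℚ.* a (suc n)           ≡⟨ ℚ.+-comm (conv (b ∘ suc) a n) (b 0 ℚ.* a (suc n)) ⟩
  conv b a (suc n)                                   ∎

conv-distribˡ : ∀ a b c → conv a (b ⊕ c) ≗ conv a b ⊕ conv a c
conv-distribˡ a b c n = begin
  conv a (b ⊕ c) n
    ≡⟨ sum-cong-≗ {suc n} (λ i → ℚ.*-distribˡ-+ (a (toℕ i)) (b (n ℕ.∸ toℕ i)) (c (n ℕ.∸ toℕ i))) ⟩
  sumℚ {suc n} (λ i → a (toℕ i) ℚ.* b (n ℕ.∸ toℕ i) ℚ.+ a (toℕ i) ℚ.* c (n ℕ.∸ toℕ i))
    ≡⟨ ∑-distrib-+ {suc n} (λ i → a (toℕ i) ℚ.* b (n ℕ.∸ toℕ i)) (λ i → a (toℕ i) ℚ.* c (n ℕ.∸ toℕ i)) ⟩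
  conv a b n ℚ.+ conv a c n  ∎

conv-distribʳ : ∀ a b c → conv (b ⊕ c) a ≗ conv b a ⊕ conv c a
conv-distribʳ a b c n = begin
  conv (b ⊕ c) a n            ≡⟨ conv-comm (b ⊕ c) a n ⟩
  conv a (b ⊕ c) n            ≡⟨ conv-distribˡ a b c n ⟩
  conv a b n ℚ.+ conv a c n   ≡⟨ cong₂ ℚ._+_ (conv-comm a b n) (conv-comm a c n) ⟩
  conv b a n ℚ.+ conv c a n   ∎

conv-*ˡ : ∀ q a b n → conv (λ i → q ℚ.* a i) b n ≡ q ℚ.* conv a b n
conv-*ˡ q a b n = begin
  conv (λ i → q ℚ.* a i) b n
    ≡⟨ sum-cong-≗ {suc n} (λ i → ℚ.*-assoc q (a (toℕ i)) (b (n ℕ.∸ toℕ i))) ⟩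
  sumℚ {suc n} (λ i → q ℚ.* (a (toℕ i) ℚ.* b (n ℕ.∸ toℕ i)))
    ≡⟨ *-distribˡ-sum {suc n} q (λ i → a (toℕ i) ℚ.* b (n ℕ.∸ toℕ i)) ⟨
  q ℚ.* conv a b n  ∎

conv-assoc : ∀ a b c → conv (conv a b) c ≗ conv a (conv b c)
conv-assoc a b c zero = ℚS.solve 3
  (λ x y z → (x ℚS.:* y ℚS.:+ ℚS.con 0ℚ) ℚS.:* z ℚS.:+ ℚS.con 0ℚ ℚS.:= x ℚS.:* (y ℚS.:* z ℚS.:+ ℚS.con 0ℚ) ℚS.:+ ℚS.con 0ℚ)
  refl (a 0) (b 0) (c 0)
conv-assoc a b c (suc n) = begin
  -- By definition the tail of `conv a b` is a_0 times the tail of b, plus the convolution of the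
  -- tail of a with b. The induction is therefore over all a.
  conv a b 0 ℚ.* c (suc n) ℚ.+ conv ((λ i → a 0 ℚ.* b (suc i)) ⊕ conv a′ b) c n
    ≡⟨ cong (conv a b 0 ℚ.* c (suc n) ℚ.+_) (conv-distribʳ c (λ i → a 0 ℚ.* b (suc i)) (conv a′ b) n) ⟩
  conv a b 0 ℚ.* c (suc n) ℚ.+ (conv (λ i → a 0 ℚ.* b (suc i)) c n ℚ.+ conv (conv a′ b) c n)
    ≡⟨ cong₂ (λ x y → conv a b 0 ℚ.* c (suc n) ℚ.+ (x ℚ.+ y)) (conv-*ˡ (a 0) (b ∘ suc) c n) (conv-assoc a′ b c n) ⟩
  (a 0 ℚ.* b 0 ℚ.+ 0ℚ) ℚ.* c (suc n) ℚ.+ (a 0 ℚ.* conv (b ∘ suc) c n ℚ.+ conv a′ (conv b c) n)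
    ≡⟨ ℚS.solve 5 (λ x y z v w → (x ℚS.:* y ℚS.:+ ℚS.con 0ℚ) ℚS.:* z ℚS.:+ (x ℚS.:* v ℚS.:+ w) ℚS.:= x ℚS.:* (y ℚS.:* z ℚS.:+ v) ℚS.:+ w)
         refl (a 0) (b 0) (c (suc n)) (conv (b ∘ suc) c n) (conv a′ (conv b c) n) ⟩
  a 0 ℚ.* conv b c (suc n) ℚ.+ conv a′ (conv b c) n  ∎
  where
  a′ = a ∘ suc

conv-zeroˡ : ∀ a n → conv (λ _ → 0ℚ) a n ≡ 0ℚ
conv-zeroˡ a n = trans (conv-*ˡ 0ℚ (λ _ → 0ℚ) a n) (ℚ.*-zeroˡ (conv (λ _ → 0ℚ) a n))

conv-identityˡ : ∀ a → conv one a ≗ a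
conv-identityˡ a zero    = trans (ℚ.+-identityʳ _) (ℚ.*-identityˡ (a 0))
conv-identityˡ a (suc n) = begin
  1ℚ ℚ.* a (suc n) ℚ.+ conv (λ _ → 0ℚ) a n  ≡⟨ cong₂ ℚ._+_ (ℚ.*-identityˡ (a (suc n))) (conv-zeroˡ a n) ⟩
  a (suc n) ℚ.+ 0ℚ                          ≡⟨ ℚ.+-identityʳ _ ⟩
  a (suc n)                                 ∎

conv-constantˡ : ∀ q a n → conv (constant q) a n ≡ q ℚ.* a n
conv-constantˡ q a n = trans (conv-*ˡ q one a n) (cong (q ℚ.*_) (conv-identityˡ a n))

constant-1 : constant 1ℚ ≗ one
constant-1 n = ℚ.*-identityˡ (one n)

constant-0 : ∀ n → constant 0ℚ n ≡ 0ℚ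
constant-0 n = ℚ.*-zeroˡ (one n)

-- Zero and one are taken as images of `constant`, so that they coincide with the series of the
-- Laurent `0#` and `1#`.
seriesRing : CommutativeRing 0ℓ 0ℓ
seriesRing = record
  { Carrier = Series
  ; _≈_ = _≗_
  ; _+_ = _⊕_
  ; _*_ = conv
  ; -_  = ⊖_
  ; 0#  = constant 0ℚ
  ; 1#  = constant 1ℚ
  ; isCommutativeRing = record
    { isRing = record
      { +-isAbelianGroup = record
        { isGroup = record
          { isMonoid = record
            { isSemigroup = record
              { isMagma = record
                { isEquivalence = record
                  { refl  = λ _ → refl
                  ; sym   = λ p n → sym (p n)
                  ; trans = λ p q n → trans (p n) (q n)
                  }
                ; ∙-cong = λ p q n → cong₂ ℚ._+_ (p n) (q n)
                }
              ; assoc = λ a b c n → ℚ.+-assoc (a n) (b n) (c n)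
              }
            ; identity =
                (λ a n → trans (cong (ℚ._+ a n) (constant-0 n)) (ℚ.+-identityˡ (a n)))
              , (λ a n → trans (cong (a n ℚ.+_) (constant-0 n)) (ℚ.+-identityʳ (a n)))
            }
          ; inverse =
              (λ a n → trans (ℚ.+-inverseˡ (a n)) (sym (constant-0 n)))
            , (λ a n → trans (ℚ.+-inverseʳ (a n)) (sym (constant-0 n)))
          ; ⁻¹-cong = λ p n → cong ℚ.-_ (p n)
          }
        ; comm = λ a b n → ℚ.+-comm (a n) (b n)
        }
      ; *-cong = conv-cong
      ; *-assoc = conv-assoc
      ; *-identity =
          (λ a n → trans (conv-constantˡ 1ℚ a n) (ℚ.*-identityˡ (a n)))
        , (λ a n → trans (conv-comm a (constant 1ℚ) n) (trans (conv-constantˡ 1ℚ a n) (ℚ.*-identityˡ (a n))))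
      ; distrib = conv-distribˡ , conv-distribʳ
      }
    ; *-comm = conv-comm
    }
  }

-- The formal derivative.

δ : Series → Series
δ a n = fromℕ (suc n) ℚ.* a (suc n)

δ-⊕ : ∀ a b → δ (a ⊕ b) ≗ δ a ⊕ δ b
δ-⊕ a b n = ℚ.*-distribˡ-+ (fromℕ (suc n)) (a (suc n)) (b (suc n))

δ-⊖ : ∀ a → δ (⊖ a) ≗ ⊖ δ a
δ-⊖ a n = sym (ℚ.neg-distribʳ-* (fromℕ (suc n)) (a (suc n)))

δ-constant : ∀ q → δ (constant q) ≗ constant 0ℚ
δ-constant q n = begin
  fromℕ (suc n) ℚ.* (q ℚ.* 0ℚ)  ≡⟨ cong (fromℕ (suc n) ℚ.*_) (ℚ.*-zeroʳ q) ⟩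
  fromℕ (suc n) ℚ.* 0ℚ          ≡⟨ ℚ.*-zeroʳ (fromℕ (suc n)) ⟩
  0ℚ                            ≡⟨ constant-0 n ⟨
  constant 0ℚ n                 ∎

-- θ = t·δ; its Leibniz rule holds term by term, since n = i + (n - i).
θ : Series → Series
θ a n = fromℕ n ℚ.* a n

θ-conv : ∀ a b → θ (conv a b) ≗ conv (θ a) b ⊕ conv a (θ b)
θ-conv a b n = begin
  fromℕ n ℚ.* conv a b n
    ≡⟨ *-distribˡ-sum {suc n} (fromℕ n) (λ i → a (toℕ i) ℚ.* b (n ℕ.∸ toℕ i)) ⟩
  sumℚ {suc n} (λ i → fromℕ n ℚ.* (a (toℕ i) ℚ.* b (n ℕ.∸ toℕ i)))
    ≡⟨ sum-cong-≗ {suc n} term ⟩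
  sumℚ {suc n} (λ i → θ a (toℕ i) ℚ.* b (n ℕ.∸ toℕ i) ℚ.+ a (toℕ i) ℚ.* θ b (n ℕ.∸ toℕ i))
    ≡⟨ ∑-distrib-+ {suc n} (λ i → θ a (toℕ i) ℚ.* b (n ℕ.∸ toℕ i)) (λ i → a (toℕ i) ℚ.* θ b (n ℕ.∸ toℕ i)) ⟩
  conv (θ a) b n ℚ.+ conv a (θ b) n  ∎
  where
  term : ∀ (i : Fin (suc n)) → fromℕ n ℚ.* (a (toℕ i) ℚ.* b (n ℕ.∸ toℕ i)) ≡
         θ a (toℕ i) ℚ.* b (n ℕ.∸ toℕ i) ℚ.+ a (toℕ i) ℚ.* θ b (n ℕ.∸ toℕ i)
  term i = begin
    fromℕ n ℚ.* (x ℚ.* y)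
      ≡⟨ cong (λ m → fromℕ m ℚ.* (x ℚ.* y)) (ℕ.m+[n∸m]≡n (Fin.toℕ≤pred[n] i)) ⟨
    fromℕ (k ℕ.+ (n ℕ.∸ k)) ℚ.* (x ℚ.* y)
      ≡⟨ cong (ℚ._* (x ℚ.* y)) (fromℕ-+ k (n ℕ.∸ k)) ⟩
    (fromℕ k ℚ.+ fromℕ (n ℕ.∸ k)) ℚ.* (x ℚ.* y)
      ≡⟨ ℚS.solve 4 (λ k l x y → (k ℚS.:+ l) ℚS.:* (x ℚS.:* y) ℚS.:= k ℚS.:* x ℚS.:* y ℚS.:+ x ℚS.:* (l ℚS.:* y)) refl (fromℕ k) (fromℕ (n ℕ.∸ k)) x y ⟩
    fromℕ k ℚ.* x ℚ.* y ℚ.+ x ℚ.* (fromℕ (n ℕ.∸ k) ℚ.* y)  ∎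
    where
    k = toℕ i
    x = a k
    y = b (n ℕ.∸ k)

-- θ a has constant term 0 and tail δ a.
conv-θˡ : ∀ a b n → conv (θ a) b (suc n) ≡ conv (δ a) b n
conv-θˡ a b n = begin
  0ℚ ℚ.* a 0 ℚ.* b (suc n) ℚ.+ conv (δ a) b n
    ≡⟨ ℚS.solve 3 (λ x y z → ℚS.con 0ℚ ℚS.:* x ℚS.:* y ℚS.:+ z ℚS.:= z) refl (a 0) (b (suc n)) (conv (δ a) b n) ⟩
  conv (δ a) b n  ∎

-- By definition δ at n is θ at n+1, so the Leibniz rule carries over; commutativity moves the
-- differentiated factor to the left, where `conv-θˡ` applies.
δ-conv : ∀ a b → δ (conv a b) ≗ conv (δ a) b ⊕ conv a (δ b)
δ-conv a b n = begin
  θ (conv a b) (suc n)                                 ≡⟨ θ-conv a b (suc n) ⟩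
  conv (θ a) b (suc n) ℚ.+ conv a (θ b) (suc n)        ≡⟨ cong (conv (θ a) b (suc n) ℚ.+_) (conv-comm a (θ b) (suc n)) ⟩
  conv (θ a) b (suc n) ℚ.+ conv (θ b) a (suc n)        ≡⟨ cong₂ ℚ._+_ (conv-θˡ a b n) (conv-θˡ b a n) ⟩
  conv (δ a) b n ℚ.+ conv (δ b) a n                    ≡⟨ cong (conv (δ a) b n ℚ.+_) (conv-comm (δ b) a n) ⟩
  conv (δ a) b n ℚ.+ conv a (δ b) n                    ∎

δ-egf : ∀ a → δ (series (egf a)) ≗ series (egf (a ∘ suc))
δ-egf a n = begin
  fromℕ (suc n) ℚ.* (a (suc n) ℚ.* 1/ suc n !)   ≡⟨ ℚS.solve 3 (λ x y z → x ℚS.:* (y ℚS.:* z) ℚS.:= y ℚS.:* (x ℚS.:* z)) refl (fromℕ (suc n)) (a (suc n)) (1/ suc n !) ⟩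
  a (suc n) ℚ.* (fromℕ (suc n) ℚ.* 1/ suc n !)   ≡⟨ cong (a (suc n) ℚ.*_) (suc-*-1/! n) ⟩
  a (suc n) ℚ.* 1/ n !                           ∎

-- Laurent series

≈-refl : ∀ {f} → f ≈ f
≈-refl k = refl

≈-sym : ∀ {f g} → f ≈ g → g ≈ f
≈-sym p k = sym (p k)

≈-trans : ∀ {f g h} → f ≈ g → g ≈ h → f ≈ h
≈-trans p q k = trans (p k) (q k)

mkLaurent-cong : ∀ {m n a b} → m ≡ n → a ≗ b → mkLaurent m a ≈ mkLaurent n b
mkLaurent-cong {m} refl a≗b k = at-cong a≗b (k ℤ.+ + m)

mkLaurent-injective : ∀ m {a b} → mkLaurent m a ≈ mkLaurent m b → a ≗ b
mkLaurent-injective m {a} {b} p i = begin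
  a i                        ≡⟨ cong (at a) i≡k+m ⟩
  at a (+ i ℤ.- + m ℤ.+ + m)  ≡⟨ p (+ i ℤ.- + m) ⟩
  at b (+ i ℤ.- + m ℤ.+ + m)  ≡⟨ cong (at b) i≡k+m ⟨
  b i                        ∎
  where
  i≡k+m : + i ≡ + i ℤ.- + m ℤ.+ + m
  i≡k+m = sym (trans (ℤ.+-assoc (+ i) (ℤ.- + m) (+ m))
    (trans (cong (λ x → + i ℤ.+ x) (ℤ.+-inverseˡ (+ m))) (ℤ.+-identityʳ (+ i))))

shift-pole : ∀ d {m n} a → n ≡ d ℕ.+ m → mkLaurent n (shift d a) ≈ mkLaurent m a
shift-pole d {m} a refl = coeff-shift d m a

-- Cross-multiplication of fractions with powers of t as denominators. It turns coefficientwise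
-- equality into an equality of power series.
cross-shift : ∀ {f g} → f ≈ g → shift (pole g) (series f) ≗ shift (pole f) (series g)
cross-shift {mkLaurent m a} {mkLaurent n b} p = mkLaurent-injective (n ℕ.+ m)
  (≈-trans (coeff-shift n m a) (≈-trans p (≈-sym (shift-pole m b (ℕ.+-comm n m)))))

-- The product is defined on representatives. Shifting each product by the pole order of the other
-- brings both to one pole order, where `cross-shift` compares them.
*-congʳ : ∀ {f g} h → f ≈ g → f * h ≈ g * h
*-congʳ {f@(mkLaurent m a)} {g@(mkLaurent n b)} (mkLaurent o c) p =
  ≈-trans {g = mkLaurent (n ℕ.+ (m ℕ.+ o)) (shift n (conv a c))} (≈-sym (coeff-shift n (m ℕ.+ o) (conv a c)))
  (≈-trans {g = mkLaurent (m ℕ.+ (n ℕ.+ o)) (shift m (conv b c))} (mkLaurent-cong pole-eq series-eq) (coeff-shift m (n ℕ.+ o) (conv b c)))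
  where
  pole-eq : n ℕ.+ (m ℕ.+ o) ≡ m ℕ.+ (n ℕ.+ o)
  pole-eq = solve 3 (λ m n o → n :+ (m :+ o) := m :+ (n :+ o)) refl m n o
    where open ℕSolver.+-*-Solver
  series-eq : shift n (conv a c) ≗ shift m (conv b c)
  series-eq i = begin
    shift n (conv a c) i  ≡⟨ conv-shiftˡ n a c i ⟨
    conv (shift n a) c i  ≡⟨ conv-congˡ c (cross-shift {f} {g} p) i ⟩
    conv (shift m b) c i  ≡⟨ conv-shiftˡ m b c i ⟩
    shift m (conv b c) i  ∎

*-comm : ∀ f g → f * g ≈ g * f
*-comm (mkLaurent m a) (mkLaurent n b) = mkLaurent-cong (ℕ.+-comm m n) (conv-comm a b)

*-cong : ∀ {f f′ g g′} → f ≈ f′ → g ≈ g′ → f * g ≈ f′ * g′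
*-cong {f} {f′} {g} {g′} p q =
  ≈-trans {f * g} {f′ * g} (*-congʳ {f} {f′} g p)
  (≈-trans {f′ * g} {g * f′} (*-comm f′ g)
  (≈-trans {g * f′} {g′ * f′} (*-congʳ {g} {g′} f′ q) (*-comm g′ f′)))

*-assoc : ∀ f g h → (f * g) * h ≈ f * (g * h)
*-assoc (mkLaurent m a) (mkLaurent n b) (mkLaurent o c) = mkLaurent-cong (ℕ.+-assoc m n o) (conv-assoc a b c)

*-identityˡ : ∀ f → 1# * f ≈ f
*-identityˡ (mkLaurent m a) = mkLaurent-cong refl (CommutativeRing.*-identityˡ seriesRing a)

at-⊕ : ∀ a b z → at (a ⊕ b) z ≡ at a z ℚ.+ at b z
at-⊕ a b (+ n)    = refl
at-⊕ a b -[1+ n ] = refl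

at-⊖ : ∀ a z → at (⊖ a) z ≡ ℚ.- at a z
at-⊖ a (+ n)    = refl
at-⊖ a -[1+ n ] = refl

-- On coefficients addition is pointwise, so the additive laws come from ℚ even where the
-- representatives differ.
coeff-+ : ∀ f g k → coeff (f + g) k ≡ coeff f k ℚ.+ coeff g k
coeff-+ (mkLaurent m a) (mkLaurent n b) k = trans
  (at-⊕ (shift n a) (shift m b) (k ℤ.+ + (m ℕ.+ n)))
  (cong₂ ℚ._+_ (shift-pole n a (ℕ.+-comm m n) k) (coeff-shift m n b k))

coeff-‿- : ∀ f k → coeff (- f) k ≡ ℚ.- coeff f k
coeff-‿- (mkLaurent m a) k = at-⊖ a (k ℤ.+ + m)

coeff-0# : ∀ k → coeff 0# k ≡ 0ℚ
coeff-0# k with k ℤ.+ + 0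
... | + n      = constant-0 n
... | -[1+ _ ] = refl

+-cong : ∀ {f f′ g g′} → f ≈ f′ → g ≈ g′ → f + g ≈ f′ + g′
+-cong {f} {f′} {g} {g′} p q k = begin
  coeff (f + g) k              ≡⟨ coeff-+ f g k ⟩
  coeff f k ℚ.+ coeff g k      ≡⟨ cong₂ ℚ._+_ (p k) (q k) ⟩
  coeff f′ k ℚ.+ coeff g′ k    ≡⟨ coeff-+ f′ g′ k ⟨
  coeff (f′ + g′) k            ∎

-‿cong : ∀ {f g} → f ≈ g → - f ≈ - g
-‿cong {f} {g} p k = begin
  coeff (- f) k    ≡⟨ coeff-‿- f k ⟩
  ℚ.- coeff f k    ≡⟨ cong ℚ.-_ (p k) ⟩
  ℚ.- coeff g k    ≡⟨ coeff-‿- g k ⟨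
  coeff (- g) k    ∎

+-assoc : ∀ f g h → (f + g) + h ≈ f + (g + h)
+-assoc f g h k = begin
  coeff (f + g + h) k                          ≡⟨ coeff-+ (f + g) h k ⟩
  coeff (f + g) k ℚ.+ coeff h k                ≡⟨ cong (ℚ._+ coeff h k) (coeff-+ f g k) ⟩
  coeff f k ℚ.+ coeff g k ℚ.+ coeff h k        ≡⟨ ℚ.+-assoc (coeff f k) (coeff g k) (coeff h k) ⟩
  coeff f k ℚ.+ (coeff g k ℚ.+ coeff h k)      ≡⟨ cong (coeff f k ℚ.+_) (coeff-+ g h k) ⟨
  coeff f k ℚ.+ coeff (g + h) k                ≡⟨ coeff-+ f (g + h) k ⟨
  coeff (f + (g + h)) k                        ∎

+-comm : ∀ f g → f + g ≈ g + f
+-comm f g k = begin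
  coeff (f + g) k            ≡⟨ coeff-+ f g k ⟩
  coeff f k ℚ.+ coeff g k    ≡⟨ ℚ.+-comm (coeff f k) (coeff g k) ⟩
  coeff g k ℚ.+ coeff f k    ≡⟨ coeff-+ g f k ⟨
  coeff (g + f) k            ∎

+-identityˡ : ∀ f → 0# + f ≈ f
+-identityˡ f k = begin
  coeff (0# + f) k            ≡⟨ coeff-+ 0# f k ⟩
  coeff 0# k ℚ.+ coeff f k    ≡⟨ cong (ℚ._+ coeff f k) (coeff-0# k) ⟩
  0ℚ ℚ.+ coeff f k            ≡⟨ ℚ.+-identityˡ (coeff f k) ⟩
  coeff f k                   ∎

+-inverseˡ : ∀ f → - f + f ≈ 0#
+-inverseˡ f k = begin
  coeff (- f + f) k               ≡⟨ coeff-+ (- f) f k ⟩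
  coeff (- f) k ℚ.+ coeff f k     ≡⟨ cong (ℚ._+ coeff f k) (coeff-‿- f k) ⟩
  ℚ.- coeff f k ℚ.+ coeff f k     ≡⟨ ℚ.+-inverseˡ (coeff f k) ⟩
  0ℚ                              ≡⟨ coeff-0# k ⟨
  coeff 0# k                      ∎

-- The two sides carry pole orders m+n+o and 2m+n+o, so they are compared by coefficients and not as
-- series.
*-distribˡ-+ : ∀ f g h → f * (g + h) ≈ f * g + f * h
*-distribˡ-+ f@(mkLaurent m a) g@(mkLaurent n b) h@(mkLaurent o c) k = begin
  at (conv a (shift o b ⊕ shift n c)) z
    ≡⟨ at-cong series-eq z ⟩
  at (shift o (conv a b) ⊕ shift n (conv a c)) z
    ≡⟨ at-⊕ (shift o (conv a b)) (shift n (conv a c)) z ⟩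
  at (shift o (conv a b)) z ℚ.+ at (shift n (conv a c)) z
    ≡⟨ cong₂ ℚ._+_ (shift-pole o (conv a b) pole-eq₁ k) (shift-pole n (conv a c) pole-eq₂ k) ⟩
  coeff (f * g) k ℚ.+ coeff (f * h) k
    ≡⟨ coeff-+ (f * g) (f * h) k ⟨
  coeff (f * g + f * h) k  ∎
  where
  z = k ℤ.+ + (m ℕ.+ (n ℕ.+ o))
  open ℕSolver.+-*-Solver using (solve; _:+_; _:=_)
  pole-eq₁ : m ℕ.+ (n ℕ.+ o) ≡ o ℕ.+ (m ℕ.+ n)
  pole-eq₁ = solve 3 (λ m n o → m :+ (n :+ o) := o :+ (m :+ n)) refl m n o
  pole-eq₂ : m ℕ.+ (n ℕ.+ o) ≡ n ℕ.+ (m ℕ.+ o)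
  pole-eq₂ = solve 3 (λ m n o → m :+ (n :+ o) := n :+ (m :+ o)) refl m n o
  series-eq : conv a (shift o b ⊕ shift n c) ≗ shift o (conv a b) ⊕ shift n (conv a c)
  series-eq i = trans (conv-distribˡ a (shift o b) (shift n c) i)
    (cong₂ ℚ._+_ (conv-shiftʳ o a b i) (conv-shiftʳ n a c i))

laurentRing : CommutativeRing 0ℓ 0ℓ
laurentRing = record
  { Carrier = Laurent
  ; _≈_ = _≈_
  ; _+_ = _+_
  ; _*_ = _*_
  ; -_  = -_
  ; 0#  = 0#
  ; 1#  = 1#
  ; isCommutativeRing = record
    { isRing = record
      { +-isAbelianGroup = record
        { isGroup = record
          { isMonoid = record
            { isSemigroup = record
              { isMagma = record
                { isEquivalence = record
                  { refl  = λ {f} → ≈-refl {f}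
                  ; sym   = λ {f} {g} → ≈-sym {f} {g}
                  ; trans = λ {f} {g} {h} → ≈-trans {f} {g} {h}
                  }
                ; ∙-cong = λ {f} {f′} {g} {g′} → +-cong {f} {f′} {g} {g′}
                }
              ; assoc = +-assoc
              }
            ; identity = +-identityˡ , λ f → ≈-trans {f + 0#} {0# + f} {f} (+-comm f 0#) (+-identityˡ f)
            }
          ; inverse = +-inverseˡ , λ f → ≈-trans {f - f} {(- f) + f} {0#} (+-comm f (- f)) (+-inverseˡ f)
          ; ⁻¹-cong = λ {f} {g} → -‿cong {f} {g}
          }
        ; comm = +-comm
        }
      ; *-cong = λ {f} {f′} {g} {g′} → *-cong {f} {f′} {g} {g′}
      ; *-assoc = *-assoc
      ; *-identity = *-identityˡ , λ f → ≈-trans {f * 1#} {1# * f} {f} (*-comm f 1#) (*-identityˡ f)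
      ; distrib = *-distribˡ-+ , λ f g h →
          ≈-trans {(g + h) * f} {f * (g + h)} {g * f + h * f} (*-comm (g + h) f)
          (≈-trans {f * (g + h)} {f * g + f * h} {g * f + h * f} (*-distribˡ-+ f g h)
            (+-cong {f * g} {g * f} {f * h} {h * f} (*-comm f g) (*-comm f h)))
      }
    ; *-comm = *-comm
    }
  }

-- Generating functions of the p-Bernoulli numbers

constant-hom : CommutativeRing.rawRing ℚ.+-*-commutativeRing -Raw-AlmostCommutative⟶ fromCommutativeRing seriesRing
constant-hom = record
  { ⟦_⟧    = constant
  ; +-homo = λ p q n → ℚ.*-distribʳ-+ (one n) p q
  ; *-homo = λ p q n → trans (ℚ.*-assoc p q (one n)) (sym (conv-constantˡ p (constant q) n))
  ; -‿homo = λ p n → sym (ℚ.neg-distribˡ-* p (one n))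
  ; 0-homo = λ n → refl
  ; 1-homo = λ n → refl
  }

const-hom : CommutativeRing.rawRing ℚ.+-*-commutativeRing -Raw-AlmostCommutative⟶ fromCommutativeRing laurentRing
const-hom = record
  { ⟦_⟧    = const
  ; +-homo = λ p q → mkLaurent-cong refl (S.+-homo p q)
  ; *-homo = λ p q → mkLaurent-cong refl (S.*-homo p q)
  ; -‿homo = λ p → mkLaurent-cong refl (S.-‿homo p)
  ; 0-homo = λ k → refl
  ; 1-homo = λ k → refl
  }
  where module S = _-Raw-AlmostCommutative⟶_ constant-hom

module SeriesAlgebra = ℚAlgebra seriesRing constant-hom
module LaurentAlgebra = ℚAlgebra laurentRing const-hom

-- The step hypothesis expresses that the series solve a homogeneous linear
-- system of differential equations.
zero-unique : ∀ {I : Set} (X : I → Series) → (∀ i → X i 0 ≡ 0ℚ) →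
              (∀ n → (∀ i → X i n ≡ 0ℚ) → ∀ i → δ (X i) n ≡ 0ℚ) →
              ∀ n i → X i n ≡ 0ℚ
zero-unique X base step zero    i = base i
zero-unique X base step (suc n) i = suc-cancelˡ n
  (trans (step n (zero-unique X base step n) i) (sym (ℚ.*-zeroʳ (fromℕ (suc n)))))

⊕⊖≡0⇒≡ : ∀ x y → x ℚ.+ ℚ.- y ≡ 0ℚ → x ≡ y
⊕⊖≡0⇒≡ x y eq = begin
  x                    ≡⟨ ℚS.solve 2 (λ x y → x ℚS.:= x ℚS.:+ (ℚS.:- y) ℚS.:+ y) refl x y ⟩
  x ℚ.+ ℚ.- y ℚ.+ y    ≡⟨ cong (ℚ._+ y) eq ⟩
  0ℚ ℚ.+ y             ≡⟨ ℚ.+-identityˡ y ⟩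
  y                    ∎

δ-constant-conv : ∀ q a → δ (conv (constant q) a) ≗ conv (constant q) (δ a)
δ-constant-conv q a n = begin
  fromℕ (suc n) ℚ.* conv (constant q) a (suc n)   ≡⟨ cong (fromℕ (suc n) ℚ.*_) (conv-constantˡ q a (suc n)) ⟩
  fromℕ (suc n) ℚ.* (q ℚ.* a (suc n))             ≡⟨ ℚS.solve 3 (λ x y z → x ℚS.:* (y ℚS.:* z) ℚS.:= y ℚS.:* (x ℚS.:* z)) refl (fromℕ (suc n)) q (a (suc n)) ⟩
  q ℚ.* δ a n                                     ≡⟨ conv-constantˡ q (δ a) n ⟨
  conv (constant q) (δ a) n                       ∎

-- Differential equations of e^{pt}, w, F_p and the defects.

c : ℕ → ℚ
c p = + (suc p ℕ.^ 2) / suc (suc p)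

c-eq : ∀ p → c p ℚ.* fromℕ (suc (suc p)) ≡ fromℕ (suc p) ℚ.* fromℕ (suc p)
c-eq p = begin
  c p ℚ.* fromℕ (suc (suc p))          ≡⟨ ℚ.*-comm (c p) (fromℕ (suc (suc p))) ⟩
  fromℕ (suc (suc p)) ℚ.* c p          ≡⟨ fromℕ-*-/ (suc p ℕ.^ 2) (suc (suc p)) ⟩
  fromℕ (suc p ℕ.* (suc p ℕ.* 1))      ≡⟨ cong (λ m → fromℕ (suc p ℕ.* m)) (ℕ.*-identityʳ (suc p)) ⟩
  fromℕ (suc p ℕ.* suc p)              ≡⟨ fromℕ-* (suc p) (suc p) ⟩
  fromℕ (suc p) ℚ.* fromℕ (suc p)      ∎

e : ℕ → Series
e p = series e^[ p ·t]

W : Series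
W = series e^t-1

F : ℕ → Series
F p = series (egf (λ n → B n p))

δ-e : ∀ p → δ (e p) ≗ conv (constant (fromℕ p)) (e p)
δ-e p n = begin
  δ (e p) n                                   ≡⟨ δ-egf (λ n → fromℕ (p ℕ.^ n)) n ⟩
  fromℕ (p ℕ.* p ℕ.^ n) ℚ.* 1/ n !            ≡⟨ cong (ℚ._* 1/ n !) (fromℕ-* p (p ℕ.^ n)) ⟩
  fromℕ p ℚ.* fromℕ (p ℕ.^ n) ℚ.* 1/ n !      ≡⟨ ℚ.*-assoc (fromℕ p) (fromℕ (p ℕ.^ n)) (1/ n !) ⟩
  fromℕ p ℚ.* e p n                           ≡⟨ conv-constantˡ (fromℕ p) (e p) n ⟨
  conv (constant (fromℕ p)) (e p) n           ∎

δ-e1 : δ (e 1) ≗ e 1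
δ-e1 n = trans (δ-e 1 n) (CommutativeRing.*-identityˡ seriesRing (e 1) n)

δ-W : δ W ≗ e 1
δ-W n = begin
  δ W n                                 ≡⟨ δ-⊕ (e 1) (⊖ constant 1ℚ) n ⟩
  δ (e 1) n ℚ.+ δ (⊖ constant 1ℚ) n     ≡⟨ cong₂ ℚ._+_ (δ-e1 n) (trans (δ-⊖ (constant 1ℚ) n) (cong ℚ.-_ (trans (δ-constant 1ℚ n) (constant-0 n)))) ⟩
  e 1 n ℚ.+ 0ℚ                          ≡⟨ ℚ.+-identityʳ (e 1 n) ⟩
  e 1 n                                 ∎

-- The recursion in n, because δ shifts the coefficients of an exponential generating function by
-- one.
δ-F : ∀ p → δ (F p) ≗ conv (constant (fromℕ p)) (F p) ⊕ ⊖ conv (constant (c p)) (F (suc p))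
δ-F p n = begin
  δ (F p) n
    ≡⟨ δ-egf (λ n → B n p) n ⟩
  (fromℕ p ℚ.* B n p ℚ.- c p ℚ.* B n (suc p)) ℚ.* 1/ n !
    ≡⟨ ℚS.solve 5 (λ p x c y z → (p ℚS.:* x ℚS.:- c ℚS.:* y) ℚS.:* z ℚS.:= p ℚS.:* (x ℚS.:* z) ℚS.:- c ℚS.:* (y ℚS.:* z))
         refl (fromℕ p) (B n p) (c p) (B n (suc p)) (1/ n !) ⟩
  fromℕ p ℚ.* F p n ℚ.- c p ℚ.* F (suc p) n
    ≡⟨ cong₂ ℚ._-_ (conv-constantˡ (fromℕ p) (F p) n) (conv-constantˡ (c p) (F (suc p)) n) ⟨
  conv (constant (fromℕ p)) (F p) n ℚ.- conv (constant (c p)) (F (suc p)) n  ∎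

e1≗W+1 : e 1 ≗ W ⊕ constant 1ℚ
e1≗W+1 n = ℚS.solve 2 (λ x y → x ℚS.:= x ℚS.:+ (ℚS.:- y) ℚS.:+ y) refl (e 1 n) (constant 1ℚ n)

-- m stands for p+1; it is a parameter because defect-derivative writes the p+2 of
-- the next defect as (p+1)+1.
defectWith : Series → ℕ → Series
defectWith m p = conv m (conv (e 1) (F p) ⊕ ⊖ constant 1ℚ) ⊕ ⊖ conv (constant (c p)) (conv W (F (suc p)))

defect : ℕ → Series
defect p = defectWith (constant (fromℕ (suc p))) p

defectWith-cong : ∀ {m m′} p → m ≗ m′ → defectWith m p ≗ defectWith m′ p
defectWith-cong p m≗m′ n = cong (ℚ._+ _) (conv-congˡ (conv (e 1) (F p) ⊕ ⊖ constant 1ℚ) m≗m′ n)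

constant-suc : ∀ p → constant (fromℕ (suc p)) ≗ constant (fromℕ p) ⊕ constant 1ℚ
constant-suc p n = begin
  fromℕ (suc p) ℚ.* one n              ≡⟨ cong (ℚ._* one n) (fromℕ-suc p) ⟩
  (1ℚ ℚ.+ fromℕ p) ℚ.* one n           ≡⟨ ℚS.solve 2 (λ x y → (ℚS.con 1ℚ ℚS.:+ x) ℚS.:* y ℚS.:= x ℚS.:* y ℚS.:+ ℚS.con 1ℚ ℚS.:* y) refl (fromℕ p) (one n) ⟩
  fromℕ p ℚ.* one n ℚ.+ 1ℚ ℚ.* one n   ∎

δ-defect : ∀ p → δ (defect p) ≗
  conv (constant (fromℕ (suc p))) (defect p) ⊕ ⊖ conv (constant (c p)) (defect (suc p))
δ-defect p n = begin
  δ (defect p) n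
    ≡⟨ δ-⊕ (conv N A) (⊖ conv K (conv W f′)) n ⟩
  δ (conv N A) n ℚ.+ δ (⊖ conv K (conv W f′)) n
    ≡⟨ cong₂ ℚ._+_ (trans (δ-constant-conv (fromℕ (suc p)) A n) (conv-cong {N} (λ _ → refl) δ-A n))
         (trans (δ-⊖ (conv K (conv W f′)) n) (cong ℚ.-_
           (trans (δ-constant-conv (c p) (conv W f′) n) (conv-cong {K} (λ _ → refl) δ-Wf′ n)))) ⟩
  conv N (conv E f ⊕ conv E (conv (N ⊕ ⊖ constant 1ℚ) f ⊕ ⊖ conv K f′)) n
    ℚ.+ ℚ.- conv K (conv E f′ ⊕ conv W (conv N f′ ⊕ ⊖ conv K′ f″)) n
    ≡⟨ SeriesAlgebra.defect-derivative N K K′ E W f f′ f″ e1≗W+1 K*[N+1]≗N*N n ⟩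
  conv N (defect p) n ℚ.+ ℚ.- conv K (defectWith (N ⊕ constant 1ℚ) (suc p)) n
    ≡⟨ cong (λ x → conv N (defect p) n ℚ.+ ℚ.- x)
         (conv-cong {K} (λ _ → refl) (defectWith-cong (suc p) (constant-suc (suc p))) n) ⟨
  conv N (defect p) n ℚ.+ ℚ.- conv K (defect (suc p)) n  ∎
  where
  N  = constant (fromℕ (suc p))
  K  = constant (c p)
  K′ = constant (c (suc p))
  E  = e 1
  f  = F p
  f′ = F (suc p)
  f″ = F (suc (suc p))
  A  = conv E f ⊕ ⊖ constant 1ℚ
  K*[N+1]≗N*N : conv K (N ⊕ constant 1ℚ) ≗ conv N N
  K*[N+1]≗N*N i = begin
    conv K (N ⊕ constant 1ℚ) i                     ≡⟨ conv-cong {K} (λ _ → refl) (constant-suc (suc p)) i ⟨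
    conv K (constant (fromℕ (suc (suc p)))) i      ≡⟨ conv-constantˡ (c p) (constant (fromℕ (suc (suc p)))) i ⟩
    c p ℚ.* (fromℕ (suc (suc p)) ℚ.* one i)        ≡⟨ ℚ.*-assoc (c p) (fromℕ (suc (suc p))) (one i) ⟨
    c p ℚ.* fromℕ (suc (suc p)) ℚ.* one i          ≡⟨ cong (ℚ._* one i) (c-eq p) ⟩
    fromℕ (suc p) ℚ.* fromℕ (suc p) ℚ.* one i      ≡⟨ ℚ.*-assoc (fromℕ (suc p)) (fromℕ (suc p)) (one i) ⟩
    fromℕ (suc p) ℚ.* N i                          ≡⟨ conv-constantˡ (fromℕ (suc p)) N i ⟨
    conv N N i                                     ∎
  -- `defect-derivative` speaks of n = p+1 only, so the coefficient p in the equation for F_p′ has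
  -- to appear as n - 1.
  N-1 : constant (fromℕ p) ≗ N ⊕ ⊖ constant 1ℚ
  N-1 i = sym (trans (cong (ℚ._+ ℚ.- constant 1ℚ i) (constant-suc p i))
    (ℚS.solve 2 (λ x y → x ℚS.:+ y ℚS.:- y ℚS.:= x) refl (constant (fromℕ p) i) (constant 1ℚ i)))
  δ-f : δ f ≗ conv (N ⊕ ⊖ constant 1ℚ) f ⊕ ⊖ conv K f′
  δ-f i = trans (δ-F p i) (cong (ℚ._- conv K f′ i) (conv-congˡ f N-1 i))
  δ-A : δ A ≗ conv E f ⊕ conv E (conv (N ⊕ ⊖ constant 1ℚ) f ⊕ ⊖ conv K f′)
  δ-A i = begin
    δ A i
      ≡⟨ δ-⊕ (conv E f) (⊖ constant 1ℚ) i ⟩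
    δ (conv E f) i ℚ.+ δ (⊖ constant 1ℚ) i
      ≡⟨ cong₂ ℚ._+_ (δ-conv E f i) (trans (δ-⊖ (constant 1ℚ) i) (cong ℚ.-_ (trans (δ-constant 1ℚ i) (constant-0 i)))) ⟩
    conv (δ E) f i ℚ.+ conv E (δ f) i ℚ.+ 0ℚ
      ≡⟨ ℚ.+-identityʳ _ ⟩
    conv (δ E) f i ℚ.+ conv E (δ f) i
      ≡⟨ cong₂ ℚ._+_ (conv-congˡ f δ-e1 i) (conv-cong {E} (λ _ → refl) δ-f i) ⟩
    conv E f i ℚ.+ conv E (conv (N ⊕ ⊖ constant 1ℚ) f ⊕ ⊖ conv K f′) i  ∎
  δ-Wf′ : δ (conv W f′) ≗ conv E f′ ⊕ conv W (conv N f′ ⊕ ⊖ conv K′ f″)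
  δ-Wf′ i = trans (δ-conv W f′ i)
    (cong₂ ℚ._+_ (conv-congˡ f′ δ-W i) (conv-cong {W} (λ _ → refl) (δ-F (suc p)) i))

defect≡0 : ∀ n p → defect p n ≡ 0ℚ
defect≡0 = zero-unique defect base step
  where
  base : ∀ p → defect p 0 ≡ 0ℚ
  base p = begin
    defect p 0
      ≡⟨ cong₂ ℚ._-_ (conv-constantˡ (fromℕ (suc p)) (conv (e 1) (F p) ⊕ ⊖ constant 1ℚ) 0)
                     (conv-constantˡ (c p) (conv W (F (suc p))) 0) ⟩
    -- Both zeros are found by evaluation: e^t and F_p have constant term 1, and w has constant term
    -- 0.
    fromℕ (suc p) ℚ.* 0ℚ ℚ.- c p ℚ.* 0ℚ
      ≡⟨ ℚS.solve 2 (λ x y → x ℚS.:* ℚS.con 0ℚ ℚS.:- y ℚS.:* ℚS.con 0ℚ ℚS.:= ℚS.con 0ℚ) refl (fromℕ (suc p)) (c p) ⟩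
    0ℚ ∎
  step : ∀ n → (∀ p → defect p n ≡ 0ℚ) → ∀ p → δ (defect p) n ≡ 0ℚ
  step n ih p = begin
    δ (defect p) n
      ≡⟨ δ-defect p n ⟩
    conv (constant (fromℕ (suc p))) (defect p) n ℚ.- conv (constant (c p)) (defect (suc p)) n
      ≡⟨ cong₂ ℚ._-_ (conv-constantˡ (fromℕ (suc p)) (defect p) n) (conv-constantˡ (c p) (defect (suc p)) n) ⟩
    fromℕ (suc p) ℚ.* defect p n ℚ.- c p ℚ.* defect (suc p) n
      ≡⟨ cong₂ (λ x y → fromℕ (suc p) ℚ.* x ℚ.- c p ℚ.* y) (ih p) (ih (suc p)) ⟩
    fromℕ (suc p) ℚ.* 0ℚ ℚ.- c p ℚ.* 0ℚ
      ≡⟨ ℚS.solve 2 (λ x y → x ℚS.:* ℚS.con 0ℚ ℚS.:- y ℚS.:* ℚS.con 0ℚ ℚS.:= ℚS.con 0ℚ) refl (fromℕ (suc p)) (c p) ⟩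
    0ℚ ∎

W*F-suc : ∀ p → conv (constant (c p)) (conv W (F (suc p))) ≗
          conv (constant (fromℕ (suc p))) (conv (W ⊕ constant 1ℚ) (F p) ⊕ ⊖ constant 1ℚ)
W*F-suc p n = begin
  conv (constant (c p)) (conv W (F (suc p))) n
    ≡⟨ ⊕⊖≡0⇒≡ (conv (constant (fromℕ (suc p))) (conv (e 1) (F p) ⊕ ⊖ constant 1ℚ) n) _ (defect≡0 n p) ⟨
  conv (constant (fromℕ (suc p))) (conv (e 1) (F p) ⊕ ⊖ constant 1ℚ) n
    ≡⟨ conv-cong {constant (fromℕ (suc p))} (λ _ → refl)
         (λ i → cong (ℚ._- constant 1ℚ i) (conv-congˡ (F p) e1≗W+1 i)) n ⟩
  conv (constant (fromℕ (suc p))) (conv (W ⊕ constant 1ℚ) (F p) ⊕ ⊖ constant 1ℚ) n  ∎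

δ-t : δ (series t) ≗ one
δ-t zero    = refl
δ-t (suc n) = ℚ.*-zeroʳ (fromℕ (suc (suc n)))

-- F_0 is the generating function t/(e^t - 1) of the Bernoulli numbers, the base case for the
-- induction on p in `F-closed`.
W*F-zero : conv W (F 0) ≗ series t
W*F-zero n = ⊕⊖≡0⇒≡ (conv W (F 0) n) (series t n)
  (zero-unique {⊤} (λ _ → conv W (F 0) ⊕ ⊖ series t) (λ _ → refl) (λ n _ _ → step n) n tt)
  where
  step : ∀ n → δ (conv W (F 0) ⊕ ⊖ series t) n ≡ 0ℚ
  step n = begin
    δ (conv W (F 0) ⊕ ⊖ series t) n
      ≡⟨ δ-⊕ (conv W (F 0)) (⊖ series t) n ⟩
    δ (conv W (F 0)) n ℚ.+ δ (⊖ series t) n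
      ≡⟨ cong₂ ℚ._+_ (δ-conv W (F 0) n) (trans (δ-⊖ (series t) n) (cong ℚ.-_ (trans (δ-t n) (sym (constant-1 n))))) ⟩
    conv (δ W) (F 0) n ℚ.+ conv W (δ (F 0)) n ℚ.- constant 1ℚ n
      ≡⟨ cong (ℚ._- constant 1ℚ n) (cong₂ ℚ._+_ (conv-congˡ (F 0) δ-W n) (conv-cong {W} (λ _ → refl) (δ-F 0) n)) ⟩
    conv (e 1) (F 0) n ℚ.+ conv W (conv (constant 0ℚ) (F 0) ⊕ ⊖ conv (constant (c 0)) (F 1)) n ℚ.- constant 1ℚ n
      ≡⟨ SeriesAlgebra.defect-zero (constant (c 0)) (e 1) W (F 0) (F 1) n ⟩
    defect 0 n
      ≡⟨ defect≡0 n 0 ⟩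
    0ℚ ∎

-- Rests on 0^0 = 1 for the constant term.
e-zero : e 0 ≗ constant 1ℚ
e-zero zero    = refl
e-zero (suc n) = trans (ℚ.*-zeroˡ (1/ suc n !)) (sym (ℚ.*-zeroʳ 1ℚ))

-- Both e^{(p+1)t} and e^t e^{pt} solve y′ = (p+1) y with y(0) = 1, so their difference vanishes by
-- `zero-unique`.
e-suc : ∀ p → e (suc p) ≗ conv (W ⊕ constant 1ℚ) (e p)
e-suc p n = trans
  (⊕⊖≡0⇒≡ (e (suc p) n) (conv (e 1) (e p) n)
    (zero-unique {⊤} (λ _ → difference) (λ _ → refl) (λ n ih _ → step n (ih tt)) n tt))
  (conv-congˡ (e p) e1≗W+1 n)
  where
  difference : Series
  difference = e (suc p) ⊕ ⊖ conv (e 1) (e p)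
  δ-product : ∀ n → δ (conv (e 1) (e p)) n ≡ fromℕ (suc p) ℚ.* conv (e 1) (e p) n
  δ-product n = begin
    δ (conv (e 1) (e p)) n
      ≡⟨ δ-conv (e 1) (e p) n ⟩
    conv (δ (e 1)) (e p) n ℚ.+ conv (e 1) (δ (e p)) n
      ≡⟨ cong₂ ℚ._+_ (conv-congˡ (e p) δ-e1 n) (trans (conv-cong {e 1} (λ _ → refl) (δ-e p) n) (conv-comm (e 1) (conv (constant (fromℕ p)) (e p)) n)) ⟩
    x ℚ.+ conv (conv (constant (fromℕ p)) (e p)) (e 1) n
      ≡⟨ cong (x ℚ.+_) (trans (conv-assoc (constant (fromℕ p)) (e p) (e 1) n) (trans (conv-constantˡ (fromℕ p) (conv (e p) (e 1)) n) (cong (fromℕ p ℚ.*_) (conv-comm (e p) (e 1) n)))) ⟩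
    x ℚ.+ fromℕ p ℚ.* x
      ≡⟨ ℚS.solve 2 (λ p x → x ℚS.:+ p ℚS.:* x ℚS.:= (ℚS.con 1ℚ ℚS.:+ p) ℚS.:* x) refl (fromℕ p) x ⟩
    (1ℚ ℚ.+ fromℕ p) ℚ.* x
      ≡⟨ cong (ℚ._* x) (fromℕ-suc p) ⟨
    fromℕ (suc p) ℚ.* x  ∎
    where x = conv (e 1) (e p) n
  step : ∀ n → difference n ≡ 0ℚ → δ difference n ≡ 0ℚ
  step n ih = begin
    δ difference n
      ≡⟨ δ-⊕ (e (suc p)) (⊖ conv (e 1) (e p)) n ⟩
    δ (e (suc p)) n ℚ.+ δ (⊖ conv (e 1) (e p)) n
      ≡⟨ cong₂ ℚ._+_ (trans (δ-e (suc p) n) (conv-constantˡ (fromℕ (suc p)) (e (suc p)) n))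
           (trans (δ-⊖ (conv (e 1) (e p)) n) (cong ℚ.-_ (δ-product n))) ⟩
    fromℕ (suc p) ℚ.* e (suc p) n ℚ.- fromℕ (suc p) ℚ.* conv (e 1) (e p) n
      ≡⟨ ℚS.solve 3 (λ a x y → a ℚS.:* x ℚS.:- a ℚS.:* y ℚS.:= a ℚS.:* (x ℚS.:- y)) refl (fromℕ (suc p)) (e (suc p) n) (conv (e 1) (e p) n) ⟩
    fromℕ (suc p) ℚ.* difference n
      ≡⟨ cong (fromℕ (suc p) ℚ.*_) ih ⟩
    fromℕ (suc p) ℚ.* 0ℚ
      ≡⟨ ℚ.*-zeroʳ (fromℕ (suc p)) ⟩
    0ℚ ∎

theorem1 : ∀ (p : ℕ) →
    egf (λ n → B n p) ≈
    const (fromℕ (suc p)) * (t - const (H p)) * e^[ p ·t] * (e^t-1 ⁻¹) ^ suc p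
    + const (fromℕ (suc p)) * Σ₁ p (λ k → const (fromℕ (p C k)) * const (H k) * (e^t-1 ⁻¹) ^ suc k)
theorem1 = LaurentAlgebra.F-explicit e^t-1 (e^t-1 ⁻¹) t c (λ p → egf (λ n → B n p)) e^[_·t]
  (*-inverseʳ e^t-1)
  -- All series in these relations have pole order 0, where the Laurent operations compute to those
  -- on power series.
  (mkLaurent-cong refl W*F-zero)
  (λ p → mkLaurent-cong refl (W*F-suc p))
  c-eq
  (mkLaurent-cong refl e-zero)
  (λ p → mkLaurent-cong refl (e-suc p))
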